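{- The hereditary class property "transduction of a class with bounded maximum degree" — the set of hereditary classes $\mathscr C$ for which there exist a class $\mathscr D$ of graphs of bounded maximum degree and a transduction $\mathsf T$ with $\mathscr C\subseteq\mathsf T(\mathscr D)$ — is a decomposition horizon.
   Context: Graphs are finite and simple. For a set $\Sigma$ of unary relation symbols, a $\Sigma$-expansion of a graph adds interpretations of these unary predicates (vertex colors). A simple interpretation $\mathsf I=(\nu(x),\eta(x,y))$ consists of first-order formulas in the language of $\Sigma$-expanded graphs, with $\eta$ symmetric and anti-reflexive; $\mathsf I(G^+)$ is the graph with vertex set $\nu(G^+)$ and edge set $\eta(G^+)\cap\nu(G^+)^2$. A transduction $\mathsf T$ maps a graph $G$ to $\mathsf T(G)=\{\mathsf I(G^+): G^+$ a $\Sigma$-expansion of $G\}$ (no copying of vertices), and $\mathsf T(\mathscr D)=\bigcup_{G\in\mathscr D}\mathsf T(G)$. A hereditary class is a class closed under isomorphism and induced subgraphs; a hereditary class property is a set $\Pi$ of hereditary classes closed under passing to hereditary subclasses. For non-decreasing $f$ and positive integer $p$, $\mathscr C$ has an $f$-bounded $\Pi$-decomposition with parameter $p$ if there is $\mathscr D_p\in\Pi$ such that every $G\in\mathscr C$ has a partition $V_1,\dots,V_N$ of $V(G)$, $N\le f(|G|)$, with $G[V_{i_1}\cup\dots\cup V_{i_p}]\in\mathscr D_p$ for all $i_1,\dots,i_p\in[N]$. $\Pi^\ast$ is the set of hereditary classes that, for every positive integer $p$, have such a decomposition for some non-decreasing $f$ with $f(n)=n^{o(1)}$. $\Pi$ is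 a decomposition horizon if $\Pi^\ast=\Pi$. -}

module Defs where

open import Data.Bool using (Bool; true; false)
import Data.Bool.Properties as Bool
open import Data.Fin using (Fin)
open import Data.Fin.Properties using (_≟_; any?; all?)
open import Data.Fin.Subset using (Subset; _∈_; ∣_∣)
open import Data.Fin.Subset.Properties using (_∈?_)
import Data.List as List
open import Data.List using (List; filter; allFin)
open import Data.Nat using (ℕ; suc; _≤_; _^_; NonZero)
open import Data.Product using (∃-syntax; Σ-syntax; _×_; _,_)
open import Data.Sum using (_⊎_)
open import Data.Vec using (Vec; []; _∷_; lookup; tabulate)
open import Function using (_↔_; mk⇔; Inverse)
open import Level using (0ℓ) renaming (suc to ℓsuc)
open import Relation.Binary.Definitions using (Monotonic₁)
open import Relation.Binary.PropositionalEquality using (_≡_)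
open import Relation.Nullary using (¬_; Dec; does; ¬?; _×-dec_; _⊎-dec_)
open import Relation.Nullary.Decidable using (does-⇔; dec-false)
open import Relation.Unary using (Pred; Decidable; _⊆_; _≐_)

record Graph : Set where
  field
    order      : ℕ
    adj        : Fin order → Fin order → Bool
    adj-sym    : ∀ u v → adj u v ≡ adj v u
    adj-irrefl : ∀ v → adj v v ≡ false

  Vertex : Set
  Vertex = Fin order

  Adjacent : Vertex → Vertex → Set
  Adjacent u v = adj u v ≡ true

  neighbourhood : Vertex → Subset order
  neighbourhood v = tabulate (adj v)

  degree : Vertex → ℕ
  degree v = ∣ neighbourhood v ∣

open Graph public

infix 4 _≅_

record _≅_ (G H : Graph) : Set where
  field
    vertices  : Vertex G ↔ Vertex H
    preserves : ∀ u v → adj G u v ≡ adj H (Inverse.to vertices u) (Inverse.to vertices v)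

-- Vertex sets are always initial segments Fin n, so the vertices of the
-- subgraph induced on P are numbered by their position in the increasing
-- list of the vertices satisfying P.
induced : (G : Graph) {P : Pred (Vertex G) 0ℓ} → Decidable P → Graph
induced G P? = record
  { order      = List.length vs
  ; adj        = λ i j → adj G (List.lookup vs i) (List.lookup vs j)
  ; adj-sym    = λ i j → adj-sym G (List.lookup vs i) (List.lookup vs j)
  ; adj-irrefl = λ i → adj-irrefl G (List.lookup vs i)
  }
  where
  vs : List (Vertex G)
  vs = filter P? (allFin (order G))

Class : Set₁
Class = Pred Graph 0ℓ

record HereditaryClass : Set₁ where
  field
    members        : Class
    iso-closed     : ∀ {G H} → G ≅ H → members G → members H
    induced-closed : ∀ {G} {P : Pred (Vertex G) 0ℓ} (P? : Decidable P) →
                     members G → members (induced G P?)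

open HereditaryClass public

record HereditaryClassProperty : Set₂ where
  field
    holds      : Pred HereditaryClass (ℓsuc 0ℓ)
    hereditary : ∀ C D → members C ⊆ members D → holds D → holds C

open HereditaryClassProperty public

record Expansion (Σ : Set) : Set where
  field
    graph  : Graph
    colour : Σ → Subset (order graph)

open Expansion public

infix  8 _≈_
infixr 6 _∧_
infixr 5 _∨_

-- First-order formulas over Σ-expanded graphs with free variables among
-- n de Bruijn indices; a quantifier binds index zero.
data Formula (Σ : Set) (n : ℕ) : Set where
  _≈_       : Fin n → Fin n → Formula Σ n
  edge      : Fin n → Fin n → Formula Σ n
  hasColour : Σ → Fin n → Formula Σ n
  neg       : Formula Σ n → Formula Σ n
  _∧_       : Formula Σ n → Formula Σ n → Formula Σ n
  _∨_       : Formula Σ n → Formula Σ n → Formula Σ n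
  all       : Formula Σ (suc n) → Formula Σ n
  ex        : Formula Σ (suc n) → Formula Σ n

infix 4 _⊨_[_] _⊨?_[_]

_⊨_[_] : ∀ {Σ n} (A : Expansion Σ) → Formula Σ n → Vec (Vertex (graph A)) n → Set
A ⊨ x ≈ y         [ ρ ] = lookup ρ x ≡ lookup ρ y
A ⊨ edge x y      [ ρ ] = Adjacent (graph A) (lookup ρ x) (lookup ρ y)
A ⊨ hasColour s x [ ρ ] = lookup ρ x ∈ colour A s
A ⊨ neg φ         [ ρ ] = ¬ (A ⊨ φ [ ρ ])
A ⊨ φ ∧ ψ         [ ρ ] = (A ⊨ φ [ ρ ]) × (A ⊨ ψ [ ρ ])
A ⊨ φ ∨ ψ         [ ρ ] = (A ⊨ φ [ ρ ]) ⊎ (A ⊨ ψ [ ρ ])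
A ⊨ all φ         [ ρ ] = ∀ v → A ⊨ φ [ v ∷ ρ ]
A ⊨ ex φ          [ ρ ] = ∃[ v ] (A ⊨ φ [ v ∷ ρ ])

_⊨?_[_] : ∀ {Σ n} (A : Expansion Σ) (φ : Formula Σ n) (ρ : Vec (Vertex (graph A)) n) →
          Dec (A ⊨ φ [ ρ ])
A ⊨? x ≈ y         [ ρ ] = lookup ρ x ≟ lookup ρ y
A ⊨? edge x y      [ ρ ] = adj (graph A) (lookup ρ x) (lookup ρ y) Bool.≟ true
A ⊨? hasColour s x [ ρ ] = lookup ρ x ∈? colour A s
A ⊨? neg φ         [ ρ ] = ¬? (A ⊨? φ [ ρ ])
A ⊨? φ ∧ ψ         [ ρ ] = (A ⊨? φ [ ρ ]) ×-dec (A ⊨? ψ [ ρ ])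
A ⊨? φ ∨ ψ         [ ρ ] = (A ⊨? φ [ ρ ]) ⊎-dec (A ⊨? ψ [ ρ ])
A ⊨? all φ         [ ρ ] = all? λ v → A ⊨? φ [ v ∷ ρ ]
A ⊨? ex φ          [ ρ ] = any? λ v → A ⊨? φ [ v ∷ ρ ]

record SimpleInterpretation (Σ : Set) : Set where
  field
    ν : Formula Σ 1
    η : Formula Σ 2
    η-symmetric   : ∀ A u v → A ⊨ η [ u ∷ v ∷ [] ] → A ⊨ η [ v ∷ u ∷ [] ]
    η-irreflexive : ∀ A v → ¬ (A ⊨ η [ v ∷ v ∷ [] ])

  η-graph : Expansion Σ → Graph
  η-graph A = record
    { order      = order (graph A)
    ; adj        = λ u v → does (A ⊨? η [ u ∷ v ∷ [] ])
    ; adj-sym    = λ u v → does-⇔ (mk⇔ (η-symmetric A u v) (η-symmetric A v u))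
                                  (A ⊨? η [ u ∷ v ∷ [] ]) (A ⊨? η [ v ∷ u ∷ [] ])
    ; adj-irrefl = λ v → dec-false (A ⊨? η [ v ∷ v ∷ [] ]) (η-irreflexive A v)
    }

  interpret : Expansion Σ → Graph
  interpret A = induced (η-graph A) (λ v → A ⊨? ν [ v ∷ [] ])

open SimpleInterpretation public

record Transduction : Set₁ where
  field
    Symbols        : Set
    interpretation : SimpleInterpretation Symbols

  -- Output graphs are taken up to isomorphism, since the vertex numbering
  -- chosen by `interpret` carries no meaning.
  outputs : Graph → Class
  outputs G H = Σ[ colouring ∈ (Symbols → Subset (order G)) ]
    H ≅ interpret interpretation (record { graph = G ; colour = colouring })

  image : Class → Class
  image D H = Σ[ G ∈ Graph ] D G × outputs G H

open Transduction public

-- f(n) = n^o(1), tested against the exponents ε = 1/k.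
Subpolynomial : (ℕ → ℕ) → Set
Subpolynomial f = ∀ k → .{{NonZero k}} → ∃[ n₀ ] (∀ n → n₀ ≤ n → f n ^ k ≤ n)

-- A partition V₁,…,V_N is given by the map sending a vertex to the index of
-- its part; parts may be empty.
Partition : Graph → ℕ → Set
Partition G N = Vertex G → Fin N

-- G[V_{i₁} ∪ … ∪ V_{iₚ}], where the indices need not be distinct.
unionOfParts : (G : Graph) {N p : ℕ} → Partition G N → (Fin p → Fin N) → Graph
unionOfParts G part i =
  induced G {P = λ v → ∃[ j ] part v ≡ i j} (λ v → any? λ j → part v ≟ i j)

HasPartition : (f : ℕ → ℕ) (p : ℕ) → Class → Graph → Set
HasPartition f p D G =
  Σ[ N ∈ ℕ ] N ≤ f (order G) ×
  Σ[ part ∈ Partition G N ] (∀ (i : Fin p → Fin N) → D (unionOfParts G part i))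

HasDecomposition : (f : ℕ → ℕ) (Π : HereditaryClassProperty) (p : ℕ) → HereditaryClass → Set₁
HasDecomposition f Π p C =
  Σ[ Dₚ ∈ HereditaryClass ] holds Π Dₚ × members C ⊆ HasPartition f p (members Dₚ)

infix 9 _∗

_∗ : HereditaryClassProperty → HereditaryClassProperty
holds (Π ∗) C = ∀ p → .{{NonZero p}} →
  Σ[ f ∈ (ℕ → ℕ) ] Monotonic₁ _≤_ _≤_ f × Subpolynomial f × HasDecomposition f Π p C
hereditary (Π ∗) _ _ C⊆D D∈Π∗ p =
  let f , mono , subpoly , Dₚ , Dₚ∈Π , parts = D∈Π∗ p
  in  f , mono , subpoly , Dₚ , Dₚ∈Π , λ {_} G∈C → parts (C⊆D G∈C)

IsDecompositionHorizon : HereditaryClassProperty → Set₁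
IsDecompositionHorizon Π = holds (Π ∗) ≐ holds Π

BoundedDegree : Class → Set
BoundedDegree D = ∃[ d ] (∀ G → D G → ∀ v → degree G v ≤ d)

transductionOfBoundedDegree : HereditaryClassProperty
holds transductionOfBoundedDegree C =
  Σ[ D ∈ Class ] BoundedDegree D × Σ[ T ∈ Transduction ] members C ⊆ image T D
hereditary transductionOfBoundedDegree _ _ C⊆C′ (D , bounded , T , C′⊆TD) =
  D , bounded , T , λ {_} G∈C → C′⊆TD (C⊆C′ G∈C)

{-# OPTIONS --safe #-}
module Submission where

-- One inclusion uses a single part. For the other, call vertices near twins if their
-- neighbourhoods differ in boundedly many places. By locality, a transduction of a class of
-- bounded degree produces graphs whose vertices fall into boundedly many near-twin classes.
-- Conversely, a graph with too many pairwise distant neighbourhoods contains a large ladder: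
-- vertices u_1, …, u_q with sets W_i of size q such that u_i and u_j (i < j) disagree on all
-- of W_i. If its n ≤ q + q² vertices are split into n^o(1) parts, a still large ladder lies
-- in the union of two of the parts, contradicting near-twinness for p = 2. So a class in Π∗ has bounded ladders, its adjacency
-- matrices have rows close to boundedly many patterns, and, once boundedly many bad columns
-- are recorded in the patterns, the deviations form a graph of bounded degree, from which
-- the original graph is decoded by means of vertex colours.

open import Defs

open import Data.Bool using (Bool; true; false; if_then_else_)
import Data.Bool.Properties as Bool
open import Data.Fin using (Fin; zero; suc; inject≤; inject₁; combine; remQuot; funToFin; finToFun)
open import Data.Fin.Properties
  using (_≟_; any?; injective⇒≤; inject≤-injective; inject₁-injective; combine-injectiveˡ;
         combine-injectiveʳ; finToFun-funToFin; remQuot-combine; suc-injective)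
import Data.Fin.Properties as Fin
open import Data.Fin.Subset using (Subset; ∣_∣)
import Data.Fin.Subset as Subset
import Data.Fin.Subset.Properties as Subset
open import Data.List
  using (List; []; _∷_; _++_; length; lookup; filter; allFin; tabulate; concatMap; map)
import Data.List.Membership.DecPropositional as DecMembership
open import Data.List.Membership.Propositional using (_∈_; _∉_; lose; find)
open import Data.List.Membership.Propositional.Properties
  using (∈-filter⁺; ∈-filter⁻; ∈-allFin; ∈-lookup; ∈-concatMap⁺; ∈-concatMap⁻; ∈-++⁺ˡ; ∈-++⁺ʳ;
         ∈-++⁻; ∈-map⁺; ∈-tabulate⁺)
open import Data.List.Properties using (length-++; length-map; length-tabulate)
open import Data.List.Relation.Unary.All using (All; []; _∷_)
import Data.List.Relation.Unary.All as All
open import Data.List.Relation.Unary.AllPairs using ([]; _∷_)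
open import Data.List.Relation.Unary.Any using (Any; here; there; index)
import Data.List.Relation.Unary.Any as Any
open import Data.List.Relation.Unary.Any.Properties using (lookup-index)
open import Data.List.Relation.Unary.Unique.Propositional using (Unique)
open import Data.List.Relation.Unary.Unique.Propositional.Properties using (allFin⁺; filter⁺)
open import Data.Nat using (ℕ; zero; suc; _+_; _*_; _^_; _⊔_; _≤_; _<_; z≤n; s≤s; _≤?_)
open import Data.Nat.Properties as ℕ
  using (≤-refl; ≤-trans; ≤-reflexive; ≰⇒>; ≮⇒≥; <⇒≱; module ≤-Reasoning)
open import Data.Nat.Tactic.RingSolver using (solve-∀)
open import Data.Product using (∃-syntax; Σ-syntax; _×_; _,_; proj₁; proj₂)
open import Data.Sum using (_⊎_; inj₁; inj₂; [_,_]′)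
import Data.Vec as Vec
open import Data.Vec using (Vec; []; _∷_)
open import Data.Vec.Properties using (lookup⇒[]=; []=⇒lookup; lookup∘tabulate)
open import Function using (_∘_; id; Injective; mk⇔; Inverse; Injection; mk↔ₛ′)
open import Function.Construct.Composition using (_↔-∘_)
open import Function.Construct.Identity using (↔-id)
open import Function.Properties.Inverse using (↔⇒↣)
open import Level using (0ℓ)
open import Relation.Binary.Definitions using (Monotonic₁)
open import Relation.Binary.PropositionalEquality
  using (_≡_; _≢_; refl; sym; trans; cong; cong₂; subst; module ≡-Reasoning)
open import Relation.Nullary using (¬_; Dec; yes; no; does; ¬?; contradiction; _×-dec_; _⊎-dec_)
open import Relation.Nullary.Decidable using (toSum; dec-true; dec-false; does-⇔; decidable-stable)
open import Relation.Unary using (Pred; Decidable; _⊆_)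

-- Counting with lists and injections

infix 4 _∈ᶠ?_

_∈ᶠ?_ : ∀ {n} (x : Fin n) xs → Dec (x ∈ xs)
_∈ᶠ?_ = DecMembership._∈?_ _≟_

lookup-injective : ∀ {A : Set} {xs : List A} → Unique xs → Injective _≡_ _≡_ (lookup xs)
lookup-injective (_  ∷ _)  {zero}  {zero}  _  = refl
lookup-injective (x∉ ∷ _)  {zero}  {suc j} eq = contradiction eq (All.lookup x∉ (∈-lookup j))
lookup-injective (x∉ ∷ _)  {suc i} {zero}  eq = contradiction (sym eq) (All.lookup x∉ (∈-lookup i))
lookup-injective (_  ∷ u)  {suc i} {suc j} eq = cong suc (lookup-injective u eq)

injective-into-list : ∀ {A : Set} {k} {g : Fin k → A} ys →
                      Injective _≡_ _≡_ g → (∀ i → g i ∈ ys) → k ≤ length ys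
injective-into-list {g = g} ys g-inj g∈ = injective⇒≤ {f = λ i → index (g∈ i)} λ {i} {j} eq →
  g-inj (trans (lookup-index (g∈ i)) (trans (cong (lookup ys) eq) (sym (lookup-index (g∈ j)))))

length-mono-unique : ∀ {A : Set} {xs} (ys : List A) → Unique xs → (∀ {x} → x ∈ xs → x ∈ ys) →
                     length xs ≤ length ys
length-mono-unique ys xs! xs⊆ys = injective-into-list ys (lookup-injective xs!) (xs⊆ys ∘ ∈-lookup)

select : ∀ {A : Set} {xs : List A} {k} → Unique xs → k ≤ length xs →
         Σ[ g ∈ (Fin k → A) ] Injective _≡_ _≡_ g × (∀ i → g i ∈ xs)
select {xs = xs} xs! k≤ =
  (λ i → lookup xs (inject≤ i k≤)) ,
  (λ eq → inject≤-injective k≤ k≤ _ _ (lookup-injective xs! eq)) ,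
  λ i → ∈-lookup (inject≤ i k≤)

escape : ∀ {n k} {g : Fin k → Fin n} ys → Injective _≡_ _≡_ g → length ys < k → ∃[ i ] g i ∉ ys
escape {g = g} ys g-inj ys< with any? (λ i → ¬? (g i ∈ᶠ? ys))
... | yes found = found
... | no  none  = contradiction
  (injective-into-list ys g-inj λ i → decidable-stable (g i ∈ᶠ? ys) λ g∉ → none (i , g∉))
  (<⇒≱ ys<)

length-concatMap : ∀ {A B : Set} {f : A → List B} {m} xs → (∀ x → length (f x) ≤ m) →
                   length (concatMap f xs) ≤ length xs * m
length-concatMap         []       f≤ = z≤n
length-concatMap {f = f} (x ∷ xs) f≤ =
  ≤-trans (≤-reflexive (length-++ (f x))) (ℕ.+-mono-≤ (f≤ x) (length-concatMap xs f≤))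

∈-concatMap : ∀ {A B : Set} {f : A → List B} {x y xs} → x ∈ xs → y ∈ f x → y ∈ concatMap f xs
∈-concatMap {f = f} x∈ y∈ = ∈-concatMap⁺ f (lose x∈ y∈)

select-where : ∀ {n k} {P : Pred (Fin n) 0ℓ} (P? : Decidable P) →
               k ≤ length (filter P? (allFin n)) →
               Σ[ g ∈ (Fin k → Fin n) ] Injective _≡_ _≡_ g × (∀ i → P (g i))
select-where {n} P? k≤ with select (filter⁺ P? (allFin⁺ n)) k≤
... | g , g-inj , g∈ = g , g-inj , λ i → proj₂ (∈-filter⁻ P? {xs = allFin n} (g∈ i))

∈-filter-allFin : ∀ {n} {P : Pred (Fin n) 0ℓ} (P? : Decidable P) {v} → P v → v ∈ filter P? (allFin n)
∈-filter-allFin P? {v} = ∈-filter⁺ P? (∈-allFin v)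

-- If every fibre had at most `m` elements, the `K` fibres together could not exhaust `Fin s`.
pigeonhole : ∀ {s K m} (colour : Fin s → Fin K) → K * m < s →
             ∃[ a ] Σ[ g ∈ (Fin (suc m) → Fin s) ] Injective _≡_ _≡_ g × (∀ i → colour (g i) ≡ a)
pigeonhole {s} {K} {m} colour Km<s
  with any? (λ a → suc m ≤? length (filter (λ i → colour i ≟ a) (allFin s)))
... | yes (a , large) = a , select-where (λ i → colour i ≟ a) large
... | no  none = contradiction
  (injective-into-list {g = id} (concatMap fibre (allFin K)) id λ i →
     ∈-concatMap (∈-allFin (colour i)) (∈-filter-allFin (λ j → colour j ≟ colour i) refl))
  (<⇒≱ (≤-trans (s≤s total) Km<s))
  where
  fibre : Fin K → List (Fin s)
  fibre a = filter (λ i → colour i ≟ a) (allFin s)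
  total : length (concatMap fibre (allFin K)) ≤ K * m
  total = ≤-trans
    (length-concatMap (allFin K) λ a → ℕ.≤-pred (≰⇒> λ large → none (a , large)))
    (≤-reflexive (cong (_* m) (length-tabulate {n = K} id)))

-- Greedy colouring: each new vertex takes one of the D + 1 colours that its at most D listed
-- neighbours do not carry. A vertex may be listed as its own neighbour, hence the conclusion
-- `u ≡ v`.
properColouring : ∀ {n D} (nbrs : Fin n → List (Fin n)) →
  (∀ v → length (nbrs v) ≤ D) → (∀ {u v} → u ∈ nbrs v → v ∈ nbrs u) →
  Σ[ e ∈ (Fin n → Fin (suc D)) ] (∀ {u v} → u ∈ nbrs v → e u ≡ e v → u ≡ v)
properColouring {n} {D} nbrs bounded symmetric =
  let e , proper = colourAll (allFin n) in e , proper (∈-allFin _) (∈-allFin _)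
  where
  Proper : List (Fin n) → (Fin n → Fin (suc D)) → Set
  Proper vs e = ∀ {u v} → u ∈ vs → v ∈ vs → u ∈ nbrs v → e u ≡ e v → u ≡ v

  colourAll : ∀ vs → Σ[ e ∈ (Fin n → Fin (suc D)) ] Proper vs e
  colourAll []       = (λ _ → zero) , λ ()
  colourAll (x ∷ vs) with colourAll vs
  ... | e , proper
    with escape {g = id} (map e (nbrs x)) id
           (s≤s (≤-trans (≤-reflexive (length-map e (nbrs x))) (bounded x)))
  ... | a , free = e′ , proper′
    where
    e′ : Fin n → Fin (suc D)
    e′ v with v ≟ x
    ... | yes _ = a
    ... | no  _ = e v

    proper′ : Proper (x ∷ vs) e′
    proper′ {u} {v} u∈ v∈ u~v eq with u ≟ x | v ≟ x
    ... | yes refl | yes refl = refl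
    ... | yes refl | no  _    = contradiction
      (subst (_∈ map e (nbrs x)) (sym eq) (∈-map⁺ e (symmetric u~v))) free
    ... | no  _    | yes refl = contradiction
      (subst (_∈ map e (nbrs x)) eq (∈-map⁺ e u~v)) free
    ... | no  u≢x  | no  v≢x  = proper (Any.tail u≢x u∈) (Any.tail v≢x v∈) u~v eq

∣tabulate∣ : ∀ {A : Set} {n} (f : A → Bool) (g : Fin n → A) →
             ∣ Vec.tabulate (f ∘ g) ∣ ≡ length (filter (λ a → f a Bool.≟ true) (tabulate g))
∣tabulate∣ {n = zero}  f g = refl
∣tabulate∣ {n = suc n} f g with f (g zero) Bool.≟ true
... | yes _ = cong suc (∣tabulate∣ f (g ∘ suc))
... | no  _ = ∣tabulate∣ f (g ∘ suc)

degree-length : ∀ G v → degree G v ≡ length (filter (λ w → adj G v w Bool.≟ true) (allFin (order G)))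
degree-length G v = ∣tabulate∣ (adj G v) id

-- Locality of first-order formulas over coloured graphs of bounded degree

-- A reflexive symmetric relation of bounded degree with a vertex colouring. It need not come from
-- the edges of a graph, because each round of the game squares the relation and enlarges the
-- palette.
record Hued (n D K : ℕ) : Set where
  field
    nbrs         : Fin n → List (Fin n)
    hue          : Fin n → Fin K
    nbrs-refl    : ∀ v → v ∈ nbrs v
    nbrs-sym     : ∀ {u v} → u ∈ nbrs v → v ∈ nbrs u
    nbrs-bounded : ∀ v → length (nbrs v) ≤ D

-- One-sided, so that each transfer lemma is proved once and then applied in both directions of
-- `Similar`.
record Sim {n D K} (L : Hued n D K) {a} (x y : Vec (Fin n) a) : Set where
  open Hued L
  field
    hue≡  : ∀ i → hue (Vec.lookup x i) ≡ hue (Vec.lookup y i)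
    near  : ∀ i j → Vec.lookup x j ∈ nbrs (Vec.lookup x i) → Vec.lookup y j ∈ nbrs (Vec.lookup y i)
    equal : ∀ i j → Vec.lookup x j ≡ Vec.lookup x i → Vec.lookup y j ≡ Vec.lookup y i

open Sim

Similar : ∀ {n D K} (L : Hued n D K) {a} (x y : Vec (Fin n) a) → Set
Similar L x y = Sim L x y × Sim L y x

bit : Bool → Fin 2
bit b = if b then suc zero else zero

bit-true : ∀ {A B : Set} (A? : Dec A) (B? : Dec B) → bit (does A?) ≡ bit (does B?) → A → B
bit-true A?      (yes b) eq a = b
bit-true (yes _) (no ¬b) () a
bit-true (no ¬a) (no ¬b) eq a = contradiction a ¬a

-- The hues seen among the neighbours of a vertex form a subset of `Fin K`. Its characteristic
-- function is packed into the new hue, which costs the factor 2 ^ K.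
withNbrHues : ∀ {n K} (nbrs : Fin n → List (Fin n)) (hue : Fin n → Fin K) →
  Σ[ hue′ ∈ (Fin n → Fin (K * 2 ^ K)) ] (∀ {x y} → hue′ x ≡ hue′ y →
    hue x ≡ hue y × (∀ {w} → w ∈ nbrs x → ∃[ w′ ] w′ ∈ nbrs y × hue w′ ≡ hue w))
withNbrHues {n} {K} nbrs hue = hue′ , λ {x} {y} eq → combine-injectiveˡ (hue x) _ (hue y) _ eq , transfer eq
  where
  occurs? : ∀ x a → Dec (Any (λ w → hue w ≡ a) (nbrs x))
  occurs? x a = Any.any? (λ w → hue w ≟ a) (nbrs x)

  signature : Fin n → Fin K → Fin 2
  signature x a = bit (does (occurs? x a))

  hue′ : Fin n → Fin (K * 2 ^ K)
  hue′ x = combine (hue x) (funToFin (signature x))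

  transfer : ∀ {x y} → hue′ x ≡ hue′ y → ∀ {w} → w ∈ nbrs x → ∃[ w′ ] w′ ∈ nbrs y × hue w′ ≡ hue w
  transfer {x} {y} eq {w} w∈ = find (bit-true (occurs? x (hue w)) (occurs? y (hue w)) signature≡ (lose w∈ refl))
    where
    signature≡ : signature x (hue w) ≡ signature y (hue w)
    signature≡ = begin
      signature x (hue w)                       ≡⟨ finToFun-funToFin (signature x) (hue w) ⟨
      finToFun (funToFin (signature x)) (hue w)
        ≡⟨ cong (λ k → finToFun k (hue w)) (combine-injectiveʳ (hue x) _ (hue y) _ eq) ⟩
      finToFun (funToFin (signature y)) (hue w) ≡⟨ finToFun-funToFin (signature y) (hue w) ⟩
      signature y (hue w)                       ∎
      where open ≡-Reasoning

-- The second factor is the greedy palette for the relation `close`, one more than its degree bound.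
separatedHues : ℕ → ℕ → ℕ → ℕ
separatedHues a D K = K * suc ((D * D) * (D * D) + a * D)

refinedHues : ℕ → ℕ → ℕ → ℕ
refinedHues a D K = separatedHues a D K * 2 ^ separatedHues a D K

-- One round of the back-and-forth game on tuples of length a. A vertex near the tuple is
-- identified by its hue, because the new hues separate vertices at distance four. A vertex
-- far from the tuple is replaced by another one of its hue, unless that hue is too rare to
-- avoid the neighbours of the a entries; vertices of rare hues get hues of their own.
module Refine {n D K : ℕ} (a : ℕ) (L : Hued n D K) where
  open Hued L

  nbrs² : Fin n → List (Fin n)
  nbrs² v = concatMap nbrs (nbrs v)

  ∈nbrs² : ∀ {u v w} → u ∈ nbrs v → w ∈ nbrs u → w ∈ nbrs² v
  ∈nbrs² = ∈-concatMap

  nbrs²-sym : ∀ {u v} → u ∈ nbrs² v → v ∈ nbrs² u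
  nbrs²-sym {v = v} u∈ with find (∈-concatMap⁻ nbrs {xs = nbrs v} u∈)
  ... | w , w∈ , u∈w = ∈nbrs² (nbrs-sym u∈w) (nbrs-sym w∈)

  nbrs²-bounded : ∀ v → length (nbrs² v) ≤ D * D
  nbrs²-bounded v = ≤-trans (length-concatMap (nbrs v) nbrs-bounded) (ℕ.*-monoˡ-≤ D (nbrs-bounded v))

  fibre : Fin K → List (Fin n)
  fibre c = filter (λ v → hue v ≟ c) (allFin n)

  rare : Fin K → List (Fin n)
  rare c with length (fibre c) ≤? a * D
  ... | yes _ = fibre c
  ... | no  _ = []

  rare-bounded : ∀ c → length (rare c) ≤ a * D
  rare-bounded c with length (fibre c) ≤? a * D
  ... | yes few = few
  ... | no  _   = z≤n

  rare-hue : ∀ {c v} → v ∈ rare c → hue v ≡ c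
  rare-hue {c} v∈ with length (fibre c) ≤? a * D
  ... | yes _ = proj₂ (∈-filter⁻ (λ v → hue v ≟ c) {xs = allFin n} v∈)
  rare-hue () | no _

  rare-sym : ∀ {u v} → u ∈ rare (hue v) → v ∈ rare (hue u)
  rare-sym {u} {v} u∈ rewrite rare-hue u∈ with length (fibre (hue v)) ≤? a * D
  ... | yes _ = ∈-filter-allFin (λ w → hue w ≟ hue v) refl
  rare-sym {u} {v} () | no _

  close : Fin n → List (Fin n)
  close v = concatMap nbrs² (nbrs² v) ++ rare (hue v)

  close-bounded : ∀ v → length (close v) ≤ (D * D) * (D * D) + a * D
  close-bounded v = ≤-trans (≤-reflexive (length-++ (concatMap nbrs² (nbrs² v))))
    (ℕ.+-mono-≤ (≤-trans (length-concatMap (nbrs² v) nbrs²-bounded)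
                         (ℕ.*-monoˡ-≤ (D * D) (nbrs²-bounded v)))
                (rare-bounded (hue v)))

  close-sym : ∀ {u v} → u ∈ close v → v ∈ close u
  close-sym {u} {v} u∈ with ∈-++⁻ (concatMap nbrs² (nbrs² v)) u∈
  ... | inj₂ u∈rare = ∈-++⁺ʳ (concatMap nbrs² (nbrs² u)) (rare-sym u∈rare)
  ... | inj₁ u∈⁴ with find (∈-concatMap⁻ nbrs² {xs = nbrs² v} u∈⁴)
  ...   | w , w∈ , u∈w = ∈-++⁺ˡ (∈-concatMap (nbrs²-sym u∈w) (nbrs²-sym w∈))

  separation : Σ[ e ∈ (Fin n → Fin (suc ((D * D) * (D * D) + a * D))) ]
               (∀ {u v} → u ∈ close v → e u ≡ e v → u ≡ v)
  separation = properColouring close close-bounded close-sym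

  sep : Fin n → Fin (separatedHues a D K)
  sep v = combine (hue v) (proj₁ separation v)

  sep-hue : ∀ {u v} → sep u ≡ sep v → hue u ≡ hue v
  sep-hue {u} {v} = combine-injectiveˡ (hue u) _ (hue v) _

  sep-close : ∀ {u v} → u ∈ close v → sep u ≡ sep v → u ≡ v
  sep-close {u} {v} u∈ eq = proj₂ separation u∈ (combine-injectiveʳ (hue u) _ (hue v) _ eq)

  sep-distance₄ : ∀ {u v w} → w ∈ nbrs² v → u ∈ nbrs² w → sep u ≡ sep v → u ≡ v
  sep-distance₄ w∈ u∈ = sep-close (∈-++⁺ˡ (∈-concatMap w∈ u∈))

  refined : Hued n (D * D) (refinedHues a D K)
  refined = record
    { nbrs         = nbrs²
    ; hue          = proj₁ (withNbrHues nbrs sep)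
    ; nbrs-refl    = λ v → ∈nbrs² (nbrs-refl v) (nbrs-refl v)
    ; nbrs-sym     = nbrs²-sym
    ; nbrs-bounded = nbrs²-bounded
    }

  module _ {x y : Vec (Fin n) a} (x⇒y : Sim refined x y) where

    sep≡ : ∀ i → sep (Vec.lookup x i) ≡ sep (Vec.lookup y i)
    sep≡ i = proj₁ (proj₂ (withNbrHues nbrs sep) (hue≡ x⇒y i))

    nbrSep : ∀ i {w} → w ∈ nbrs (Vec.lookup x i) → ∃[ w′ ] w′ ∈ nbrs (Vec.lookup y i) × sep w′ ≡ sep w
    nbrSep i = proj₂ (proj₂ (withNbrHues nbrs sep) (hue≡ x⇒y i))

    -- Some `w` near the j-th entry of `y` has the separating hue of `z`, hence that of `z′`. The
    -- i-th and j-th entries of `y` are at distance at most two, so `w` and `z′` are at distance at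
    -- most four and coincide.
    near-transfer : ∀ i j {z z′} → z ∈ nbrs (Vec.lookup x i) → z′ ∈ nbrs (Vec.lookup y i) → sep z ≡ sep z′ →
                    z ∈ nbrs (Vec.lookup x j) → z′ ∈ nbrs (Vec.lookup y j)
    near-transfer i j z∈ᵢ z′∈ᵢ eq z∈ⱼ with nbrSep j z∈ⱼ
    ... | w , w∈ , w≡ = subst (_∈ nbrs (Vec.lookup y j)) w≡z′ w∈
      where
      y~ : Vec.lookup y j ∈ nbrs² (Vec.lookup y i)
      y~ = near x⇒y i j (∈nbrs² z∈ᵢ (nbrs-sym z∈ⱼ))
      w≡z′ : w ≡ _
      w≡z′ with find (∈-concatMap⁻ nbrs {xs = nbrs (Vec.lookup y i)} y~)
      ... | v , v∈ , y∈ = sep-distance₄ (∈nbrs² (nbrs-sym z′∈ᵢ) v∈) (∈nbrs² y∈ w∈) (trans w≡ eq)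

    equal-transfer : ∀ i j {z z′} → z ∈ nbrs (Vec.lookup x i) → z′ ∈ nbrs (Vec.lookup y i) → sep z ≡ sep z′ →
                     z ≡ Vec.lookup x j → z′ ≡ Vec.lookup y j
    equal-transfer i j {z} z∈ z′∈ eq refl = sym (sep-distance₄ (∈nbrs² (nbrs-refl _) (nbrs-sym z′∈))
      (near x⇒y i j (∈nbrs² (nbrs-refl _) z∈)) (trans (sym (sep≡ j)) eq))

    -- `refined` compares only squared neighbourhoods. The original relation is recovered from the
    -- neighbour hues: the neighbour `w` with the right hue can only be the j-th entry of `y`.
    near-restrict : ∀ i j → Vec.lookup x j ∈ nbrs (Vec.lookup x i) → Vec.lookup y j ∈ nbrs (Vec.lookup y i)
    near-restrict i j x∈ with nbrSep i x∈
    ... | w , w∈ , w≡ = subst (_∈ nbrs (Vec.lookup y i)) (equal-transfer i j x∈ w∈ (sym w≡) refl) w∈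

    extend-near : ∀ i {z z′} → z ∈ nbrs (Vec.lookup x i) → z′ ∈ nbrs (Vec.lookup y i) → sep z ≡ sep z′ →
                  Sim L (z ∷ x) (z′ ∷ y)
    extend-near i {z} {z′} z∈ z′∈ eq = record
      { hue≡  = λ { zero → sep-hue eq ; (suc j) → sep-hue (sep≡ j) }
      ; near  = λ { zero    zero    _   → nbrs-refl z′
                  ; zero    (suc k) x∈z → nbrs-sym (near-transfer i k z∈ z′∈ eq (nbrs-sym x∈z))
                  ; (suc j) zero    z∈x → near-transfer i j z∈ z′∈ eq z∈x
                  ; (suc j) (suc k) x∈x → near-restrict j k x∈x }
      ; equal = λ { zero    zero    _   → refl
                  ; zero    (suc k) x≡z → sym (equal-transfer i k z∈ z′∈ eq (sym x≡z))
                  ; (suc j) zero    z≡x → equal-transfer i j z∈ z′∈ eq z≡x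
                  ; (suc j) (suc k) x≡x → equal x⇒y j k x≡x }
      }

    extend-far : ∀ {z z′} → (∀ i → z ∉ nbrs (Vec.lookup x i)) → hue z ≡ hue z′ → Sim L (z ∷ x) (z′ ∷ y)
    extend-far {z} {z′} z-far eq = record
      { hue≡  = λ { zero → eq ; (suc j) → sep-hue (sep≡ j) }
      ; near  = λ { zero    zero    _   → nbrs-refl z′
                  ; zero    (suc k) x∈z → contradiction (nbrs-sym x∈z) (z-far k)
                  ; (suc j) zero    z∈x → contradiction z∈x (z-far j)
                  ; (suc j) (suc k) x∈x → near-restrict j k x∈x }
      ; equal = λ { zero    zero    _    → refl
                  ; zero    (suc k) refl → contradiction (nbrs-refl z) (z-far k)
                  ; (suc j) zero    refl → contradiction (nbrs-refl z) (z-far j)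
                  ; (suc j) (suc k) x≡x  → equal x⇒y j k x≡x }
      }

  -- If the hue of `z` is rare, `z` is its own partner: were it near an entry of `y`, a vertex of
  -- the same separating hue would be near the entry of `x`, and that vertex is `z`. Otherwise the
  -- fibre has more than `a * D` vertices, too many for the neighbours of the entries of `y`.
  far-partner : ∀ {x y} → Similar refined x y → ∀ z → (∀ i → z ∉ nbrs (Vec.lookup x i)) →
                ∃[ z′ ] hue z ≡ hue z′ × (∀ i → z′ ∉ nbrs (Vec.lookup y i))
  far-partner {x} {y} (_ , y⇒x) z z-far with length (fibre (hue z)) ≤? a * D in eq
  ... | yes few = z , refl , λ i z∈y → let w , w∈x , w≡z = nbrSep y⇒x i z∈y in
    let w~z = ∈-++⁺ʳ (concatMap nbrs² (nbrs² z)) (rare-member (sep-hue w≡z)) in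
    z-far i (subst (_∈ nbrs (Vec.lookup x i)) (sep-close w~z w≡z) w∈x)
    where
    rare-member : ∀ {w} → hue w ≡ hue z → w ∈ rare (hue z)
    rare-member w≡z rewrite eq = ∈-filter-allFin (λ v → hue v ≟ hue z) w≡z
  ... | no many with select-where (λ v → hue v ≟ hue z) (≰⇒> many)
  ...   | g , g-inj , g-hue
    with escape (concatMap (λ i → nbrs (Vec.lookup y i)) (allFin a)) g-inj
           (s≤s (≤-trans (length-concatMap (allFin a) (λ i → nbrs-bounded (Vec.lookup y i)))
                         (≤-reflexive (cong (_* D) (length-tabulate {n = a} id)))))
  ...     | k , free = g k , sym (g-hue k) , λ i g∈ → free (∈-concatMap (∈-allFin i) g∈)

  forth : ∀ {x y} → Similar refined x y → ∀ z → ∃[ z′ ] Similar L (z ∷ x) (z′ ∷ y)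
  forth {x} {y} (x⇒y , y⇒x) z with any? (λ i → z ∈ᶠ? nbrs (Vec.lookup x i))
  ... | yes (i , z∈) with nbrSep x⇒y i z∈
  ...   | z′ , z′∈ , eq = z′ , extend-near x⇒y i z∈ z′∈ (sym eq) , extend-near y⇒x i z′∈ z∈ eq
  forth {x} {y} (x⇒y , y⇒x) z | no far with far-partner (x⇒y , y⇒x) z (λ i z∈ → far (i , z∈))
  ...   | z′ , eq , z′-far = z′ , extend-far x⇒y (λ i z∈ → far (i , z∈)) eq , extend-far y⇒x z′-far (sym eq)

-- Iterating the game and preservation of formulas

depth : ∀ {Σ n} → Formula Σ n → ℕ
depth (_ ≈ _)         = 0
depth (edge _ _)      = 0
depth (hasColour _ _) = 0
depth (neg φ)         = depth φ
depth (φ ∧ ψ)         = depth φ ⊔ depth ψ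
depth (φ ∨ ψ)         = depth φ ⊔ depth ψ
depth (all φ)         = suc (depth φ)
depth (ex φ)          = suc (depth φ)

symbols : ∀ {Σ n} → Formula Σ n → List Σ
symbols (_ ≈ _)         = []
symbols (edge _ _)      = []
symbols (hasColour s _) = s ∷ []
symbols (neg φ)         = symbols φ
symbols (φ ∧ ψ)         = symbols φ ++ symbols ψ
symbols (φ ∨ ψ)         = symbols φ ++ symbols ψ
symbols (all φ)         = symbols φ
symbols (ex φ)          = symbols φ

iteratedDegree : ℕ → ℕ → ℕ
iteratedDegree D zero    = D
iteratedDegree D (suc r) = iteratedDegree D r * iteratedDegree D r

-- Here `r` counts the rounds left and `a` the vertices already chosen; a round trades one for the
-- other.
iteratedHues : ℕ → ℕ → ℕ → ℕ → ℕ
iteratedHues D K zero    a = K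
iteratedHues D K (suc r) a = refinedHues a (iteratedDegree D r) (iteratedHues D K r (suc a))

iterated : ∀ {n D K} → Hued n D K → ∀ r a → Hued n (iteratedDegree D r) (iteratedHues D K r a)
iterated L zero    a = L
iterated L (suc r) a = Refine.refined a (iterated L r (suc a))

Sim-tail : ∀ {n D K a} {L : Hued n D K} {z z′} {x y : Vec (Fin n) a} →
           Sim L (z ∷ x) (z′ ∷ y) → Sim L x y
Sim-tail s = record
  { hue≡  = hue≡ s ∘ suc
  ; near  = λ i j → near s (suc i) (suc j)
  ; equal = λ i j → equal s (suc i) (suc j)
  }

-- A similarity survives unplayed rounds: repeating the first entry as a move gives a similarity
-- with one round fewer, from which the extra entry is dropped. The empty tuple offers no move, but
-- there the claim is vacuous.
iterated-sim : ∀ {n D K a} (L : Hued n D K) r {x y : Vec (Fin n) a} →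
               Similar (iterated L r a) x y → Sim L x y
iterated-sim         L zero    x~y = proj₁ x~y
iterated-sim {a = zero} L (suc r) x~y = record { hue≡ = λ () ; near = λ () ; equal = λ () }
iterated-sim {a = suc a} L (suc r) {x} x~y =
  Sim-tail (iterated-sim L r (proj₂ (Refine.forth (suc a) (iterated L r (suc (suc a))) x~y (Vec.head x))))

swap : ∀ {n D K a} {L : Hued n D K} {x y : Vec (Fin n) a} → Similar L x y → Similar L y x
swap (s , t) = t , s

module _ {Σ : Set} (A : Expansion Σ) where

  private
    G = graph A
    V = Vertex G

  closedNbrs : V → List V
  closedNbrs v = v ∷ filter (λ w → adj G v w Bool.≟ true) (allFin (order G))

  ∈-closedNbrs⁻ : ∀ {v w} → w ∈ closedNbrs v → w ≡ v ⊎ Adjacent G v w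
  ∈-closedNbrs⁻         (here w≡v) = inj₁ w≡v
  ∈-closedNbrs⁻ {v} (there w∈) =
    inj₂ (proj₂ (∈-filter⁻ (λ w → adj G v w Bool.≟ true) {xs = allFin (order G)} w∈))

  ∈-closedNbrs⁺ : ∀ {v w} → Adjacent G v w → w ∈ closedNbrs v
  ∈-closedNbrs⁺ {v} vw = there (∈-filter-allFin (λ w → adj G v w Bool.≟ true) vw)

  -- The symbol set may be infinite, so the hue records only a finite list, later taken to be the
  -- symbols of the formula.
  symbolHue : (ss : List Σ) → V → Fin (2 ^ length ss)
  symbolHue []       v = zero
  symbolHue (s ∷ ss) v = combine (bit (does (v Subset.∈? colour A s))) (symbolHue ss v)

  symbolHue-respects : ∀ ss {u v} → symbolHue ss u ≡ symbolHue ss v →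
                       All (λ s → u Subset.∈ colour A s → v Subset.∈ colour A s) ss
  symbolHue-respects []       eq = []
  symbolHue-respects (s ∷ ss) {u} {v} eq =
    bit-true (u Subset.∈? colour A s) (v Subset.∈? colour A s)
      (combine-injectiveˡ (bit (does (u Subset.∈? colour A s))) (symbolHue ss u) _ _ eq) ∷
    symbolHue-respects ss
      (combine-injectiveʳ (bit (does (u Subset.∈? colour A s))) (symbolHue ss u)
                          (bit (does (v Subset.∈? colour A s))) (symbolHue ss v) eq)

  module _ {d} (degree≤ : ∀ v → degree G v ≤ d) (ss : List Σ) where

    base : Hued (order G) (suc d) (2 ^ length ss)
    base = record
      { nbrs         = closedNbrs
      ; hue          = symbolHue ss
      ; nbrs-refl    = λ v → here refl
      ; nbrs-sym     = λ {u} {v} u∈ → [ (λ { refl → here refl })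
                                      , (λ vu → ∈-closedNbrs⁺ (trans (adj-sym G u v) vu)) ]′ (∈-closedNbrs⁻ u∈)
      ; nbrs-bounded = λ v → s≤s (≤-trans (≤-reflexive (sym (degree-length G v))) (degree≤ v))
      }

    -- Induction on the formula as in an Ehrenfeucht-Fraïssé game: each quantifier uses one move of
    -- `forth`, and `neg` and `all` exchange the two sides.
    preservation : ∀ {a} (φ : Formula Σ a) r → depth φ ≤ r → (∀ {s} → s ∈ symbols φ → s ∈ ss) →
                   ∀ {x y} → Similar (iterated base r a) x y → A ⊨ φ [ x ] → A ⊨ φ [ y ]
    preservation (i ≈ j) r _ _ x~y h = equal (iterated-sim base r x~y) j i h
    preservation (edge i j) r _ _ {x} {y} x~y h
      with ∈-closedNbrs⁻ (near (iterated-sim base r x~y) i j (∈-closedNbrs⁺ h))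
    ... | inj₂ adjacent = adjacent
    -- Closed neighbourhoods contain their centre. Equality here would pull back to `x` and turn `h`
    -- into a loop.
    ... | inj₁ yⱼ≡yᵢ with equal (iterated-sim base r (swap x~y)) i j yⱼ≡yᵢ
    ...   | xⱼ≡xᵢ with trans (sym (adj-irrefl G _)) (trans (cong (adj G (Vec.lookup x i)) (sym xⱼ≡xᵢ)) h)
    ...     | ()
    preservation (hasColour s i) r _ s∈ x~y h =
      All.lookup (symbolHue-respects ss (hue≡ (iterated-sim base r x~y) i)) (s∈ (here refl)) h
    preservation (neg φ) r ≤r s∈ x~y ¬h h = ¬h (preservation φ r ≤r s∈ (swap x~y) h)
    preservation (φ ∧ ψ) r ≤r s∈ x~y (h , k) =
      preservation φ r (ℕ.m⊔n≤o⇒m≤o (depth φ) (depth ψ) ≤r) (s∈ ∘ ∈-++⁺ˡ) x~y h ,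
      preservation ψ r (ℕ.m⊔n≤o⇒n≤o (depth φ) (depth ψ) ≤r) (s∈ ∘ ∈-++⁺ʳ (symbols φ)) x~y k
    preservation (φ ∨ ψ) r ≤r s∈ x~y (inj₁ h) =
      inj₁ (preservation φ r (ℕ.m⊔n≤o⇒m≤o (depth φ) (depth ψ) ≤r) (s∈ ∘ ∈-++⁺ˡ) x~y h)
    preservation (φ ∨ ψ) r ≤r s∈ x~y (inj₂ k) =
      inj₂ (preservation ψ r (ℕ.m⊔n≤o⇒n≤o (depth φ) (depth ψ) ≤r) (s∈ ∘ ∈-++⁺ʳ (symbols φ)) x~y k)
    preservation {a} (all φ) (suc r) (s≤s ≤r) s∈ x~y h z′
      with Refine.forth a (iterated base r (suc a)) (swap x~y) z′
    ... | z , z′~z = preservation φ r ≤r s∈ (swap z′~z) (h z)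
    preservation {a} (ex φ) (suc r) (s≤s ≤r) s∈ x~y (z , h)
      with Refine.forth a (iterated base r (suc a)) x~y z
    ... | z′ , z~z′ = z′ , preservation φ r ≤r s∈ z~z′ h

-- Near-twin partitions

-- Forbidding `suc k` distinct differences, instead of counting them, lets the notion pass directly
-- through embeddings.
NearTwin : ℕ → ℕ → Graph → Set
NearTwin m k G = Σ[ class ∈ (Vertex G → Fin m) ] (∀ u v → class u ≡ class v →
  (g : Fin (suc k) → Vertex G) → Injective _≡_ _≡_ g → ¬ (∀ i → adj G u (g i) ≢ adj G v (g i)))

nearTwin-embed : ∀ {m k G H} (f : Vertex H → Vertex G) → Injective _≡_ _≡_ f →
                 (∀ u v → adj H u v ≡ adj G (f u) (f v)) → NearTwin m k G → NearTwin m k H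
nearTwin-embed f f-inj f-adj (class , twins) = class ∘ f , λ u v eq g g-inj differ →
  twins (f u) (f v) eq (f ∘ g) (g-inj ∘ f-inj) λ i eq′ →
    differ i (trans (f-adj u (g i)) (trans eq′ (sym (f-adj v (g i)))))

module _ {Σ : Set} (I : SimpleInterpretation Σ) (d : ℕ) where

  private
    r  = depth (η I)
    ss = symbols (η I)

  twinClasses twinExceptions : ℕ
  twinClasses    = iteratedHues (suc d) (2 ^ length ss) r 2
  twinExceptions = iteratedDegree (suc d) r + iteratedDegree (suc d) r

  -- If `u` and `v` share a hue and `w` is near neither, the pairs `(u, w)` and `(v, w)` are similar
  -- and `η` cannot distinguish them. All differences thus lie in the two neighbourhoods.
  η-graph-nearTwin : ∀ A → (∀ v → degree (graph A) v ≤ d) → NearTwin twinClasses twinExceptions (η-graph I A)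
  η-graph-nearTwin A degree≤ = hue , twins
    where
    L = iterated (base A degree≤ ss) r 2
    open Hued L

    sim : ∀ {u v w} → hue u ≡ hue v → w ∉ nbrs u → w ∉ nbrs v → Sim L (u ∷ w ∷ []) (v ∷ w ∷ [])
    sim {u} {v} {w} eq w∉u w∉v = record
      { hue≡  = λ { zero → eq ; (suc zero) → refl }
      ; near  = λ { zero       zero       _   → nbrs-refl v
                  ; zero       (suc zero) w∈u → contradiction w∈u w∉u
                  ; (suc zero) zero       u∈w → contradiction (nbrs-sym u∈w) w∉u
                  ; (suc zero) (suc zero) _   → nbrs-refl w }
      ; equal = λ { zero       zero       _    → refl
                  ; zero       (suc zero) refl → contradiction (nbrs-refl u) w∉u
                  ; (suc zero) zero       refl → contradiction (nbrs-refl u) w∉u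
                  ; (suc zero) (suc zero) _    → refl }
      }

    twins : ∀ u v → hue u ≡ hue v → (g : Fin (suc twinExceptions) → Vertex (graph A)) → Injective _≡_ _≡_ g →
            ¬ (∀ i → adj (η-graph I A) u (g i) ≢ adj (η-graph I A) v (g i))
    twins u v eq g g-inj differ
      with escape (nbrs u ++ nbrs v) g-inj
             (s≤s (≤-trans (≤-reflexive (length-++ (nbrs u))) (ℕ.+-mono-≤ (nbrs-bounded u) (nbrs-bounded v))))
    ... | i , far = differ i (does-⇔ (mk⇔ (preserve u~v) (preserve (swap u~v)))
                                     (A ⊨? η I [ u ∷ g i ∷ [] ]) (A ⊨? η I [ v ∷ g i ∷ [] ]))
      where
      ∉u : g i ∉ nbrs u
      ∉u = far ∘ ∈-++⁺ˡ
      ∉v : g i ∉ nbrs v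
      ∉v = far ∘ ∈-++⁺ʳ (nbrs u)
      u~v : Similar L (u ∷ g i ∷ []) (v ∷ g i ∷ [])
      u~v = sim eq ∉u ∉v , sim (sym eq) ∉v ∉u
      preserve : ∀ {x y} → Similar L x y → A ⊨ η I [ x ] → A ⊨ η I [ y ]
      preserve = preservation A degree≤ ss (η I) r ≤-refl id

  interpret-nearTwin : ∀ A → (∀ v → degree (graph A) v ≤ d) → ∀ {H} → H ≅ interpret I A →
                       NearTwin twinClasses twinExceptions H
  interpret-nearTwin A degree≤ {H} H≅ =
    nearTwin-embed {G = η-graph I A} {H} (lookup vs ∘ Inverse.to (_≅_.vertices H≅))
      (Injection.injective (↔⇒↣ (_≅_.vertices H≅)) ∘ lookup-injective (filter⁺ ν? (allFin⁺ (order (graph A)))))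
      (_≅_.preserves H≅) (η-graph-nearTwin A degree≤)
    where
    ν? : ∀ v → Dec (A ⊨ ν I [ v ∷ [] ])
    ν? v = A ⊨? ν I [ v ∷ [] ]
    vs = filter ν? (allFin (order (graph A)))

-- Ladders

-- The ladder of the header without an order on the indices, so that any selection of
-- indices is again a ladder.
record Ladder (q t : ℕ) (G : Graph) : Set where
  field
    foot           : Fin q → Vertex G
    rung           : Fin q → Fin t → Vertex G
    rung-injective : ∀ i → Injective _≡_ _≡_ (rung i)
    apart          : ∀ i j → i ≢ j → (∀ l → adj G (foot i) (rung i l) ≢ adj G (foot j) (rung i l))
                                   ⊎ (∀ l → adj G (foot i) (rung j l) ≢ adj G (foot j) (rung j l))

module _ (G : Graph) {P : Pred (Vertex G) 0ℓ} (P? : Decidable P) where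

  restrict : ∀ v → P v → Vertex (induced G P?)
  restrict v Pv = index (∈-filter-allFin P? Pv)

  lookup-restrict : ∀ v (Pv : P v) → lookup (filter P? (allFin (order G))) (restrict v Pv) ≡ v
  lookup-restrict v Pv = sym (lookup-index (∈-filter-allFin P? Pv))

  adj-restrict : ∀ u (Pu : P u) v (Pv : P v) → adj (induced G P?) (restrict u Pu) (restrict v Pv) ≡ adj G u v
  adj-restrict u Pu v Pv = cong₂ (adj G) (lookup-restrict u Pu) (lookup-restrict v Pv)

  restrict-injective : ∀ {u Pu v Pv} → restrict u Pu ≡ restrict v Pv → u ≡ v
  restrict-injective {u} {Pu} {v} {Pv} eq =
    trans (sym (lookup-restrict u Pu))
          (trans (cong (lookup (filter P? (allFin (order G)))) eq) (lookup-restrict v Pv))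

  Ladder-restrict : ∀ {q t} (L : Ladder q t G) → (∀ i → P (Ladder.foot L i)) →
                    (∀ i l → P (Ladder.rung L i l)) → Ladder q t (induced G P?)
  Ladder-restrict {q} L P-foot P-rung = record
    { foot           = λ i → restrict (foot i) (P-foot i)
    ; rung           = λ i l → restrict (rung i l) (P-rung i l)
    ; rung-injective = λ i eq → rung-injective i (restrict-injective eq)
    ; apart          = λ i j i≢j → [ (λ differ → inj₁ λ l → differ l ∘ adj⁻ i j i l)
                                   , (λ differ → inj₂ λ l → differ l ∘ adj⁻ i j j l) ]′ (apart i j i≢j)
    }
    where
    open Ladder L
    adj⁻ : ∀ i j k l →
      adj (induced G P?) (restrict (foot i) (P-foot i)) (restrict (rung k l) (P-rung k l)) ≡
      adj (induced G P?) (restrict (foot j) (P-foot j)) (restrict (rung k l) (P-rung k l)) →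
      adj G (foot i) (rung k l) ≡ adj G (foot j) (rung k l)
    adj⁻ i j k l eq = trans (sym (adj-restrict (foot i) (P-foot i) (rung k l) (P-rung k l)))
                      (trans eq (adj-restrict (foot j) (P-foot j) (rung k l) (P-rung k l)))

subladder : ∀ {q t q′ t′ G} (L : Ladder q t G) (g : Fin q′ → Fin q) → Injective _≡_ _≡_ g →
            (h : ∀ i → Fin t′ → Fin t) → (∀ i → Injective _≡_ _≡_ (h i)) → Ladder q′ t′ G
subladder L g g-inj h h-inj = record
  { foot           = foot ∘ g
  ; rung           = λ i → rung (g i) ∘ h (g i)
  ; rung-injective = λ i → h-inj (g i) ∘ rung-injective (g i)
  ; apart          = λ i j i≢j → [ (λ differ → inj₁ (differ ∘ h (g i))) , (λ differ → inj₂ (differ ∘ h (g j))) ]′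
                                   (apart (g i) (g j) (i≢j ∘ g-inj))
  }
  where open Ladder L

-- Two of the `suc m` feet share a class, yet one of their rungs separates them at `suc k` places.
nearTwin⇒¬ladder : ∀ {m k G} → NearTwin m k G → ¬ Ladder (suc m) (suc k) G
nearTwin⇒¬ladder (class , twins) L with Fin.pigeonhole ≤-refl (class ∘ Ladder.foot L)
... | i , j , i<j , eq with Ladder.apart L i j (Fin.<⇒≢ i<j)
...   | inj₁ differ = twins _ _ eq (rung i) (rung-injective i) differ where open Ladder L
...   | inj₂ differ = twins _ _ eq (rung j) (rung-injective j) differ where open Ladder L

-- Each rung has `suc k` vertices in a single part. Typing every index by the part of its foot and
-- this majority part gives N² types, so `suc m` indices agree, and their subladder lies in the
-- union of two parts.
partition⇒¬ladder : ∀ {m k N q t} G (part : Partition G N) →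
                    (∀ (i : Fin 2 → Fin N) → NearTwin m k (unionOfParts G part i)) →
                    N * k < t → N * N * m < q → ¬ Ladder q t G
partition⇒¬ladder {m} {k} {N} {q} {t} G part twins Nk<t NNm<q L =
  nearTwin⇒¬ladder (twins parts)
    (Ladder-restrict G _ (subladder L g g-inj h h-inj) (λ i → zero , foot-part i) λ i l → suc zero , rung-part i l)
  where
  open Ladder L
  majority : ∀ i → ∃[ a ] Σ[ h ∈ (Fin (suc k) → Fin t) ] Injective _≡_ _≡_ h × (∀ l → part (rung i (h l)) ≡ a)
  majority i = pigeonhole (part ∘ rung i) Nk<t
  h : ∀ i → Fin (suc k) → Fin t
  h i = proj₁ (proj₂ (majority i))
  h-inj : ∀ i → Injective _≡_ _≡_ (h i)
  h-inj i = proj₁ (proj₂ (proj₂ (majority i)))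
  types = pigeonhole (λ i → combine (part (foot i)) (proj₁ (majority i))) NNm<q
  g = proj₁ (proj₂ types)
  g-inj = proj₁ (proj₂ (proj₂ types))
  same : ∀ i → combine (part (foot (g i))) (proj₁ (majority (g i))) ≡
               combine (part (foot (g zero))) (proj₁ (majority (g zero)))
  same i = trans (proj₂ (proj₂ (proj₂ types)) i) (sym (proj₂ (proj₂ (proj₂ types)) zero))
  parts : Fin 2 → Fin N
  parts zero       = part (foot (g zero))
  parts (suc zero) = proj₁ (majority (g zero))
  foot-part : ∀ i → part (foot (g i)) ≡ parts zero
  foot-part i = combine-injectiveˡ (part (foot (g i))) _ (part (foot (g zero))) _ (same i)
  rung-part : ∀ i l → part (rung (g i) (h (g i) l)) ≡ parts (suc zero)
  rung-part i l = trans (proj₂ (proj₂ (proj₂ (majority (g i)))) l)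
    (combine-injectiveʳ (part (foot (g i))) _ (part (foot (g zero))) _ (same i))

-- Subpolynomial partitions exclude ladders

module _ {q t G} (L : Ladder q t G) where
  open Ladder L

  support : List (Vertex G)
  support = concatMap (λ i → foot i ∷ tabulate (rung i)) (allFin q)

  -- Only the vertices of the ladder are kept, so that the number of parts is bounded in terms of
  -- `q` and `t`, not of the order of `G`.
  ladderGraph : Graph
  ladderGraph = induced G (_∈ᶠ? support)

  ladderGraph-order : order ladderGraph ≤ q * suc t
  ladderGraph-order = ≤-trans
    (length-mono-unique support (filter⁺ (_∈ᶠ? support) (allFin⁺ (order G)))
      (λ v∈ → proj₂ (∈-filter⁻ (_∈ᶠ? support) {xs = allFin (order G)} v∈)))
    (≤-trans (length-concatMap (allFin q) (λ i → s≤s (≤-reflexive (length-tabulate (rung i)))))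
             (≤-reflexive (cong (_* suc t) (length-tabulate {n = q} id))))

  ladderGraph-ladder : Ladder q t ladderGraph
  ladderGraph-ladder = Ladder-restrict G (_∈ᶠ? support) L
    (λ i → ∈-concatMap (∈-allFin i) (here refl))
    (λ i l → ∈-concatMap (∈-allFin i) (there (∈-tabulate⁺ l)))

-- Cubing the first bound produces F⁶, which the second replaces by q(q + 1) ≤ 2q²; then q² cancels.
cube-bound : ∀ F M q → q ≤ F * F * M → F ^ 6 ≤ q * suc q → q ≤ 2 * M ^ 3
cube-bound F M zero    _  _  = z≤n
cube-bound F M q@(suc _) q≤ F≤ = ℕ.*-cancelˡ-≤ (q * q) (begin
  q * q * q               ≤⟨ ℕ.*-mono-≤ (ℕ.*-mono-≤ q≤ q≤) q≤ ⟩
  (F * F * M) * (F * F * M) * (F * F * M) ≡⟨ lhs F M ⟩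
  F ^ 6 * M ^ 3           ≤⟨ ℕ.*-monoˡ-≤ (M ^ 3) F≤ ⟩
  q * suc q * M ^ 3       ≤⟨ ℕ.*-monoˡ-≤ (M ^ 3) (ℕ.*-monoʳ-≤ q (ℕ.m<m+n q (s≤s z≤n))) ⟩
  q * (q + q) * M ^ 3     ≡⟨ rhs q M ⟩
  q * q * (2 * M ^ 3)     ∎)
  where
  open ≤-Reasoning
  lhs : ∀ F M → (F * F * M) * (F * F * M) * (F * F * M) ≡
                F * (F * (F * (F * (F * (F * 1))))) * (M * (M * (M * 1)))
  lhs = solve-∀
  rhs : ∀ q M → q * (q + q) * (M * (M * (M * 1))) ≡ q * q * (2 * (M * (M * (M * 1))))
  rhs = solve-∀

n≤n*n : ∀ n → n ≤ n * n
n≤n*n zero    = z≤n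
n≤n*n (suc n) = ℕ.m≤m*n (suc n) (suc n)

subpolynomial-gap : ∀ {f} → Subpolynomial f → ∀ M →
                    ∃[ q ] f (q * suc q) * f (q * suc q) * M < q
subpolynomial-gap {f} subpoly M with subpoly 6
... | n₀ , f⁶≤ = q , ≰⇒> λ q≤ → ℕ.<⇒≱ (s≤s (ℕ.m≤m+n (2 * M ^ 3) n₀))
  (cube-bound (f (q * suc q)) M q q≤
    (f⁶≤ (q * suc q) (≤-trans (ℕ.m≤n⇒m≤1+n (ℕ.m≤n+m n₀ (2 * M ^ 3))) (ℕ.m≤m*n q (suc q)))))
  where
  -- Larger than the bound `2 * M ^ 3` of `cube-bound`, and at least `n₀` so that the estimate for
  -- `f` applies at `q * suc q`.
  q = suc (2 * M ^ 3 + n₀)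

-- By heredity the decomposition applies to the ladder graph itself, of order at most `q * suc q`.
-- The constant `m + k` makes one gap serve both pigeonhole bounds.
unionsNearTwin⇒¬ladder : ∀ C {f m k} → Monotonic₁ _≤_ _≤_ f → Subpolynomial f →
                         members C ⊆ HasPartition f 2 (NearTwin m k) →
                         ∃[ q ] (∀ {G} → members C G → ¬ Ladder q q G)
unionsNearTwin⇒¬ladder C {f} {m} {k} f-mono subpoly parts with subpolynomial-gap subpoly (m + k)
... | q , gap = q , λ {G} → noLadder {G}
  where
  F = f (q * suc q)

  noLadder : ∀ {G} → members C G → ¬ Ladder q q G
  noLadder {G} G∈C L with parts (induced-closed C {G} (_∈ᶠ? support L) G∈C)
  ... | N , N≤ , part , unions = partition⇒¬ladder (ladderGraph L) part unions
    (≤-trans (s≤s (ℕ.*-mono-≤ (≤-trans N≤F (n≤n*n F)) (ℕ.m≤n+m k m))) gap)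
    (≤-trans (s≤s (ℕ.*-mono-≤ (ℕ.*-mono-≤ N≤F N≤F) (ℕ.m≤m+n m k))) gap)
    (ladderGraph-ladder L)
    where
    N≤F : N ≤ F
    N≤F = ≤-trans N≤ (f-mono (ladderGraph-order L))

decomposition⇒¬ladder : ∀ C → holds (transductionOfBoundedDegree ∗) C →
                        ∃[ q ] (∀ {G} → members C G → ¬ Ladder q q G)
decomposition⇒¬ladder C C∈Π∗ with C∈Π∗ 2
... | f , f-mono , subpoly , D₂ , (D , (d , degree≤) , T , D₂⊆TD) , parts =
  unionsNearTwin⇒¬ladder C f-mono subpoly λ G∈C →
    let N , N≤ , part , unions = parts G∈C in N , N≤ , part , λ i → twins (D₂⊆TD (unions i))
  where
  twins : ∀ {H} → image T D H → NearTwin (twinClasses (interpretation T) d) (twinExceptions (interpretation T) d) H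
  twins (G , G∈D , colouring , H≅) = interpret-nearTwin (interpretation T) d _ (degree≤ G G∈D) H≅

-- Approximating the rows of the adjacency matrix

record Approximation (m k : ℕ) (G : Graph) : Set where
  field
    class : Vertex G → Fin m
    row   : Fin m → Vertex G → Bool

  exceptions : Vertex G → List (Vertex G)
  exceptions u = filter (λ w → ¬? (adj G u w Bool.≟ row (class u) w)) (allFin (order G))

  field
    exceptions-bounded : ∀ u → length (exceptions u) ≤ k

-- Two members of a far family form the pair to be separated from the rest; the factor 2 ^ (t + t)
-- counts the agreement patterns on the places where they differ.
manyRows : ℕ → ℕ → ℕ
manyRows t zero    = 0
manyRows t (suc q) = suc (suc (2 ^ (t + t) * manyRows t q))

module _ (G : Graph) where

  private
    V = Vertex G

  diff : V → V → List V
  diff u v = filter (λ w → ¬? (adj G u w Bool.≟ adj G v w)) (allFin (order G))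

  Far : ℕ → V → V → Set
  Far t u v = t + t ≤ length (diff u v)

  Far-sym : ∀ {t u v} → Far t u v → Far t v u
  Far-sym {u = u} {v} far = ≤-trans far
    (length-mono-unique (diff v u) (filter⁺ (λ w → ¬? (adj G u w Bool.≟ adj G v w)) (allFin⁺ (order G)))
      λ w∈ → ∈-filter-allFin (λ w → ¬? (adj G v w Bool.≟ adj G u w))
        (proj₂ (∈-filter⁻ (λ w → ¬? (adj G u w Bool.≟ adj G v w)) {xs = allFin (order G)} w∈) ∘ sym))

  agreement : ∀ {t} → V → (Fin t → V) → V → Fin t → Fin 2
  agreement u D x l = bit (does (adj G x (D l) Bool.≟ adj G u (D l)))

  Separates : ∀ {t} → (Fin t → V) → V → V → Set
  Separates W u v = ∀ l → adj G u (W l) ≢ adj G v (W l)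

  record SeparatedSubfamily (t s : ℕ) (u v : V) {n} (x : Fin n → V) : Set where
    field
      centre     : V
      centre≡    : centre ≡ u ⊎ centre ≡ v
      places     : Fin t → V
      places-inj : Injective _≡_ _≡_ places
      member     : Fin s → Fin n
      member-inj : Injective _≡_ _≡_ member
      separates  : ∀ i → Separates places centre (x (member i))

  -- If x agrees with u at a place where u and v differ, it disagrees with v there; so each
  -- x disagrees with u or with v on half of the places.
  separate : ∀ {t s} u v → Far (suc t) u v → (x : Fin (suc (2 ^ (suc t + suc t) * s)) → V) →
             SeparatedSubfamily (suc t) (suc s) u v x
  separate {t} {s} u v far x
    with select-where (λ w → ¬? (adj G u w Bool.≟ adj G v w)) far
  ... | D , D-inj , D-differ
    -- The members kept share the entire agreement pattern with `u`, so the places chosen next serve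
    -- all of them at once.
    with pigeonhole (λ i → funToFin (agreement u D (x i))) ≤-refl
  ... | c , g , g-inj , g-code
    with pigeonhole {K = 2} {m = t} (finToFun {2} {suc t + suc t} c)
           (s≤s (ℕ.+-monoʳ-≤ t (≤-trans (≤-reflexive (ℕ.+-identityʳ t)) (ℕ.n≤1+n t))))
  ... | b , h , h-inj , h-bit = record
    { centre = proj₁ centred ; centre≡ = proj₁ (proj₂ centred) ; separates = proj₂ (proj₂ centred)
    ; places = D ∘ h ; places-inj = h-inj ∘ D-inj ; member = g ; member-inj = g-inj }
    where
    signature≡ : ∀ i l → agreement u D (x (g i)) (h l) ≡ b
    signature≡ i l = trans (sym (finToFun-funToFin (agreement u D (x (g i))) (h l)))
                   (trans (cong (λ k → finToFun {2} {suc t + suc t} k (h l)) (g-code i)) (h-bit l))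

    disagree : ∀ {A : Set} (A? : Dec A) → bit (does A?) ≡ zero → ¬ A
    disagree (no ¬a) _ = ¬a

    agree : ∀ {A : Set} (A? : Dec A) → bit (does A?) ≡ suc zero → A
    agree (yes a) _ = a

    split : ∀ b → (∀ i l → agreement u D (x (g i)) (h l) ≡ b) →
            Σ[ z ∈ V ] (z ≡ u ⊎ z ≡ v) × (∀ i → Separates (D ∘ h) z (x (g i)))
    split zero       eq = u , inj₁ refl , λ i l u≡x →
      disagree (adj G (x (g i)) (D (h l)) Bool.≟ adj G u (D (h l))) (eq i l) (sym u≡x)
    split (suc zero) eq = v , inj₂ refl , λ i l v≡x →
      D-differ (h l) (trans (sym (agree (adj G (x (g i)) (D (h l)) Bool.≟ adj G u (D (h l))) (eq i l))) (sym v≡x))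

    centred : Σ[ z ∈ V ] (z ≡ u ⊎ z ≡ v) × (∀ i → Separates (D ∘ h) z (x (g i)))
    centred = split b signature≡

  extend : ∀ {q t} (L : Ladder q t G) b (W : Fin t → V) → Injective _≡_ _≡_ W →
           (∀ i → Separates W b (Ladder.foot L i)) → Ladder (suc q) t G
  extend {q} {t} L b W W-inj separates = record
    { foot = foot′ ; rung = rung′ ; rung-injective = rung′-injective ; apart = apart′ }
    where
    open Ladder L
    foot′ : Fin (suc q) → V
    foot′ zero    = b
    foot′ (suc i) = foot i
    rung′ : Fin (suc q) → Fin t → V
    rung′ zero    = W
    rung′ (suc i) = rung i
    rung′-injective : ∀ i → Injective _≡_ _≡_ (rung′ i)
    rung′-injective zero    = W-inj
    rung′-injective (suc i) = rung-injective i
    apart′ : ∀ i j → i ≢ j → Separates (rung′ i) (foot′ i) (foot′ j) ⊎ Separates (rung′ j) (foot′ i) (foot′ j)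
    apart′ zero    zero    i≢j = contradiction refl i≢j
    apart′ zero    (suc j) _   = inj₁ (separates j)
    apart′ (suc i) zero    _   = inj₂ λ l → separates i l ∘ sym
    apart′ (suc i) (suc j) i≢j = apart i j (i≢j ∘ cong suc)

  -- The ladder of the separated subfamily is extended by `centre` with rung `places`. That feet
  -- come from the family is carried along, because the separation is known only for its members.
  farFamily⇒ladder : ∀ {t} q (x : Fin (suc (manyRows (suc t) q)) → V) →
                     (∀ i j → i ≢ j → Far (suc t) (x i) (x j)) →
                     Σ[ L ∈ Ladder q (suc t) G ] (∀ i → ∃[ j ] Ladder.foot L i ≡ x j)
  farFamily⇒ladder zero    x far = record { foot = λ () ; rung = λ () ; rung-injective = λ () ; apart = λ () } , λ ()
  farFamily⇒ladder (suc q) x far = extend L centre places places-inj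
      (λ i → subst (Separates places centre) (sym (proj₂ (feet i))) (separates (proj₁ (feet i))))
    , λ { zero    → [ (λ eq → zero , eq) , (λ eq → suc zero , eq) ]′ centre≡
        ; (suc i) → suc (suc (member (proj₁ (feet i)))) , proj₂ (feet i) }
    where
    open SeparatedSubfamily (separate (x zero) (x (suc zero)) (far zero (suc zero) λ ()) (λ i → x (suc (suc i))))
    smaller = farFamily⇒ladder q (λ i → x (suc (suc (member i)))) λ i j i≢j →
      far (suc (suc (member i))) (suc (suc (member j))) (i≢j ∘ member-inj ∘ suc-injective ∘ suc-injective)
    L = proj₁ smaller
    feet = proj₂ smaller

  -- A greedily built maximal set of pairwise far vertices: a vertex joins only if it is far from
  -- all earlier choices.
  representatives : ∀ t (vs : List V) → Σ[ rs ∈ List V ]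
    (∀ i j → i ≢ j → Far (suc t) (lookup rs i) (lookup rs j)) × (∀ {v} → v ∈ vs → Any (λ r → ¬ Far (suc t) v r) rs)
  representatives t []       = [] , (λ ()) , λ ()
  representatives t (v ∷ vs) with representatives t vs
  ... | rs , far , cover with Any.any? (λ r → ¬? (suc t + suc t ≤? length (diff v r))) rs
  ...   | yes near-v = rs , far , λ { (here refl) → near-v ; (there u∈) → cover u∈ }
  ...   | no  far-v  = v ∷ rs , far′ , cover′
    where
    far-v′ : ∀ i → Far (suc t) v (lookup rs i)
    far-v′ i = decidable-stable (suc t + suc t ≤? length (diff v (lookup rs i)))
      λ near → far-v (lose (∈-lookup i) near)
    far′ : ∀ i j → i ≢ j → Far (suc t) (lookup (v ∷ rs) i) (lookup (v ∷ rs) j)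
    far′ zero    zero    i≢j = contradiction refl i≢j
    far′ zero    (suc j) _   = far-v′ j
    far′ (suc i) zero    _   = Far-sym {suc t} {v} (far-v′ i)
    far′ (suc i) (suc j) i≢j = far i j (i≢j ∘ cong suc)
    cover′ : ∀ {u} → u ∈ v ∷ vs → Any (λ r → ¬ Far (suc t) u r) (v ∷ rs)
    cover′ (there u∈)  = there (cover u∈)
    -- No vertex differs from itself, and the threshold is positive, so a new representative covers
    -- itself.
    cover′ (here refl) = here λ far-vv →
      proj₂ (proj₂ (select-where (λ w → ¬? (adj G v w Bool.≟ adj G v w)) far-vv)) zero refl

  -- Without a ladder there are few representatives, and their rows serve as the patterns.
  ¬ladder⇒approximation : ∀ {q t} → ¬ Ladder q (suc t) G →
                          Approximation (manyRows (suc t) q) (suc t + suc t) G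
  ¬ladder⇒approximation {q} {t} noLadder with representatives t (allFin (order G))
  ... | rs , far , cover = record { class = class ; row = row ; exceptions-bounded = bounded }
    where
    few : length rs ≤ manyRows (suc t) q
    few = ≮⇒≥ λ many → noLadder (proj₁ (farFamily⇒ladder q (λ i → lookup rs (inject≤ i many)) λ i j i≢j →
      far (inject≤ i many) (inject≤ j many) (i≢j ∘ inject≤-injective many many i j)))

    rep : V → Fin (length rs)
    rep v = index (cover (∈-allFin v))

    class : V → Fin (manyRows (suc t) q)
    class v = inject≤ (rep v) few

    row : Fin (manyRows (suc t) q) → V → Bool
    row c w with any? (λ i → inject≤ i few ≟ c)
    ... | yes (i , _) = adj G (lookup rs i) w
    -- A class without a representative is never a value of `class`; its row gets a default.
    ... | no  _       = false

    row-inject≤ : ∀ i w → row (inject≤ i few) w ≡ adj G (lookup rs i) w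
    row-inject≤ i w with any? (λ j → inject≤ j few ≟ inject≤ i few)
    ... | yes (j , eq) = cong (λ k → adj G (lookup rs k) w) (inject≤-injective few few j i eq)
    ... | no  none     = contradiction (i , refl) none

    bounded : ∀ u → length (filter (λ w → ¬? (adj G u w Bool.≟ row (class u) w)) (allFin (order G))) ≤ suc t + suc t
    bounded u = ≤-trans
      (length-mono-unique (diff u (lookup rs (rep u)))
        (filter⁺ (λ w → ¬? (adj G u w Bool.≟ row (class u) w)) (allFin⁺ (order G)))
        λ {w} w∈ → ∈-filter-allFin (λ w → ¬? (adj G u w Bool.≟ adj G (lookup rs (rep u)) w))
          λ eq → proj₂ (∈-filter⁻ (λ w → ¬? (adj G u w Bool.≟ row (class u) w)) {xs = allFin (order G)} w∈)
                   (trans eq (sym (row-inject≤ (rep u) w))))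
      (ℕ.≰⇒≥ (lookup-index (cover (∈-allFin u))))

-- Bounding the exceptions in rows and columns

bit-injective : ∀ {b c} → bit b ≡ bit c → b ≡ c
bit-injective {true}  {true}  _ = refl
bit-injective {false} {false} _ = refl

unbit : Fin 2 → Bool
unbit zero    = false
unbit (suc _) = true

unbit-bit : ∀ b → unbit (bit b) ≡ b
unbit-bit true  = refl
unbit-bit false = refl

does-≡true : ∀ {A : Set} (A? : Dec A) {b} → (A → b ≡ true) → (b ≡ true → A) → does A? ≡ b
does-≡true (yes a) f g = sym (f a)
does-≡true (no ¬a) {true}  f g = contradiction (g refl) ¬a
does-≡true (no ¬a) {false} f g = refl

record TwoSided (m k : ℕ) (G : Graph) : Set where
  field
    class  : Vertex G → Fin m
    row    : Fin m → Vertex G → Bool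

  Exception : Vertex G → Vertex G → Set
  Exception u v = adj G u v ≢ row (class u) v

  exception? : ∀ u v → Dec (Exception u v)
  exception? u v = ¬? (adj G u v Bool.≟ row (class u) v)

  field
    cover         : Vertex G → List (Vertex G)
    cover-bounded : ∀ v → length (cover v) ≤ k
    covered       : ∀ u v → Exception u v → v ∈ cover u × u ∈ cover v

-- The columns with many exceptions are few; recording the adjacencies to them in the class
-- of a vertex removes all exceptions there.
module Heavy {m k G} (approx : Approximation m k G) where
  open Approximation approx

  private
    V = Vertex G

  exception? : ∀ u v → Dec (adj G u v ≢ row (class u) v)
  exception? u v = ¬? (adj G u v Bool.≟ row (class u) v)

  colExceptions : V → List V
  colExceptions v = filter (λ u → exception? u v) (allFin (order G))

  -- Exceeding this forces more than (k + 1)k exceptions of a column into one of the `m` classes,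
  -- enough to escape the exceptions of k + 1 rows.
  lightBound : ℕ
  lightBound = m * (suc k * k)

  Heavy : V → Set
  Heavy v = lightBound < length (colExceptions v)

  heavy? : ∀ v → Dec (Heavy v)
  heavy? v = suc lightBound ≤? length (colExceptions v)

  record Witness (v : V) : Set where
    field
      rowClass : Fin m
      vertex   : Fin (suc (suc k * k)) → V
      vertex-inj : Injective _≡_ _≡_ vertex
      vertex-class : ∀ i → class (vertex i) ≡ rowClass
      exceptional : ∀ i → adj G (vertex i) v ≢ row rowClass v

  witness : ∀ {v} → Heavy v → Witness v
  witness {v} heavy with select-where (λ u → exception? u v) heavy
  ... | g , g-inj , exc with pigeonhole (class ∘ g) ≤-refl
  ...   | c , h , h-inj , h-class = record
    { rowClass = c ; vertex = g ∘ h ; vertex-inj = h-inj ∘ g-inj ; vertex-class = h-class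
    ; exceptional = λ i → subst (λ c → adj G (g (h i)) v ≢ row c v) (h-class i) (exc (h i)) }

  heavyVertices : List V
  heavyVertices = filter heavy? (allFin (order G))

  heavyBound : ℕ
  heavyBound = m * m * 2 * k

  ∉exceptions : ∀ {u w} → w ∉ exceptions u → adj G u w ≡ row (class u) w
  ∉exceptions {u} {w} w∉ = decidable-stable (adj G u w Bool.≟ row (class u) w)
    (w∉ ∘ ∈-filter-allFin (exception? u))

  -- Otherwise k + 1 heavy vertices agree in witnessing class, own class and pattern value. Some
  -- witness `u` of the first avoids the exceptions of all their rows, so by symmetry of adjacency
  -- `u` has the same adjacency to each. Being exceptional at the first, `u` is exceptional at all k
  -- + 1, more than its row allows.
  heavy-few : length heavyVertices ≤ heavyBound
  heavy-few = ≮⇒≥ λ many → absurd (select-where heavy? many)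
    where
    absurd : ¬ (Σ[ g ∈ (Fin (suc heavyBound) → V) ] Injective _≡_ _≡_ g × (∀ i → Heavy (g i)))
    absurd (g , g-inj , g-heavy) with pigeonhole {K = m * m * 2} type ≤-refl
      where
      type : Fin (suc heavyBound) → Fin (m * m * 2)
      type i = combine (combine (Witness.rowClass (witness (g-heavy i))) (class (g i)))
                       (bit (row (Witness.rowClass (witness (g-heavy i))) (g i)))
    ... | c , h , h-inj , h-type = contradiction
      (injective-into-list {g = v} (exceptions u) (h-inj ∘ g-inj)
        λ l → ∈-filter-allFin (exception? u) (v-exception l))
      (<⇒≱ (s≤s (exceptions-bounded u)))
      where
      v : Fin (suc k) → V
      v = g ∘ h
      w : ∀ l → Witness (v l)
      w l = witness (g-heavy (h l))
      open Witness (w zero)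
      type≡ : ∀ l → _
      type≡ l = trans (h-type l) (sym (h-type zero))
      pair≡ : ∀ l → combine (Witness.rowClass (w l)) (class (v l)) ≡ combine rowClass (class (v zero))
      pair≡ l = combine-injectiveˡ (combine (Witness.rowClass (w l)) (class (v l))) _
                                   (combine rowClass (class (v zero))) _ (type≡ l)
      rowClass≡ : ∀ l → Witness.rowClass (w l) ≡ rowClass
      rowClass≡ l = combine-injectiveˡ (Witness.rowClass (w l)) _ rowClass _ (pair≡ l)
      class≡ : ∀ l → class (v l) ≡ class (v zero)
      class≡ l = combine-injectiveʳ (Witness.rowClass (w l)) _ rowClass _ (pair≡ l)
      row≡ : ∀ l → row rowClass (v l) ≡ row rowClass (v zero)
      row≡ l = trans (cong (λ c → row c (v l)) (sym (rowClass≡ l))) (bit-injective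
        (combine-injectiveʳ (combine (Witness.rowClass (w l)) (class (v l))) _
                            (combine rowClass (class (v zero))) _ (type≡ l)))

      escaped : ∃[ i ] vertex i ∉ concatMap (exceptions ∘ v) (allFin (suc k))
      escaped = escape (concatMap (exceptions ∘ v) (allFin (suc k))) vertex-inj
        (s≤s (≤-trans (length-concatMap {f = exceptions ∘ v} (allFin (suc k)) (exceptions-bounded ∘ v))
                      (≤-reflexive (cong (_* k) (length-tabulate {n = suc k} id)))))
      u : V
      u = vertex (proj₁ escaped)
      regular : ∀ l → adj G (v l) u ≡ row (class (v l)) u
      regular l = ∉exceptions (proj₂ escaped ∘ ∈-concatMap (∈-allFin l))

      v-adj : ∀ l → adj G u (v l) ≡ adj G u (v zero)
      v-adj l = begin
        adj G u (v l)          ≡⟨ adj-sym G u (v l) ⟩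
        adj G (v l) u          ≡⟨ regular l ⟩
        row (class (v l)) u    ≡⟨ cong (λ c → row c u) (class≡ l) ⟩
        row (class (v zero)) u ≡⟨ regular zero ⟨
        adj G (v zero) u       ≡⟨ adj-sym G (v zero) u ⟩
        adj G u (v zero)       ∎
        where open ≡-Reasoning

      v-exception : ∀ l → adj G u (v l) ≢ row (class u) (v l)
      v-exception l eq = exceptional (proj₁ escaped) (begin
        adj G u (v zero)          ≡⟨ v-adj l ⟨
        adj G u (v l)             ≡⟨ eq ⟩
        row (class u) (v l)       ≡⟨ cong (λ c → row c (v l)) (vertex-class (proj₁ escaped)) ⟩
        row rowClass (v l)        ≡⟨ row≡ l ⟩
        row rowClass (v zero)     ∎)
        where open ≡-Reasoning

  -- The complete graph on the heavy vertices: a proper colouring of it gives them distinct names.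
  heavyNbrs : V → List V
  heavyNbrs v with heavy? v
  ... | yes _ = heavyVertices
  ... | no  _ = []

  heavyNbrs-bounded : ∀ v → length (heavyNbrs v) ≤ heavyBound
  heavyNbrs-bounded v with heavy? v
  ... | yes _ = heavy-few
  ... | no  _ = z≤n

  ∈-heavyNbrs⁺ : ∀ {u v} → Heavy u → Heavy v → u ∈ heavyNbrs v
  ∈-heavyNbrs⁺ {v = v} heavy-u heavy-v with heavy? v
  ... | yes _     = ∈-filter-allFin heavy? heavy-u
  ... | no ¬heavy = contradiction heavy-v ¬heavy

  ∈-heavyNbrs⁻ : ∀ {u v} → u ∈ heavyNbrs v → Heavy u × Heavy v
  ∈-heavyNbrs⁻ {v = v} u∈ with heavy? v
  ... | yes heavy = proj₂ (∈-filter⁻ heavy? {xs = allFin (order G)} u∈) , heavy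
  ∈-heavyNbrs⁻ () | no _

  naming : Σ[ e ∈ (V → Fin (suc heavyBound)) ] (∀ {u v} → u ∈ heavyNbrs v → e u ≡ e v → u ≡ v)
  naming = properColouring heavyNbrs heavyNbrs-bounded λ u∈ →
    let heavy-u , heavy-v = ∈-heavyNbrs⁻ u∈ in ∈-heavyNbrs⁺ heavy-v heavy-u

  name : V → Fin (suc heavyBound)
  name = proj₁ naming

  meets? : ∀ x a → Dec (∃[ v ] Heavy v × name v ≡ a × adj G x v ≡ true)
  meets? x a = any? λ v → heavy? v ×-dec name v ≟ a ×-dec adj G x v Bool.≟ true

  meets-name : ∀ x {v} → Heavy v → does (meets? x (name v)) ≡ adj G x v
  meets-name x {v} heavy = does-≡true (meets? x (name v))
    (λ { (w , heavy-w , w≡ , xw) → trans (cong (adj G x) (sym (proj₂ naming (∈-heavyNbrs⁺ heavy-w heavy) w≡))) xw })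
    (λ xv → v , heavy , refl , xv)

  code : V → Fin (suc heavyBound) → Fin 2
  code x a = bit (does (meets? x a))

  splitClasses : ℕ
  splitClasses = m * 2 ^ suc heavyBound

  splitClass : V → Fin splitClasses
  splitClass x = combine (class x) (funToFin (code x))

  splitRow : Fin splitClasses → V → Bool
  splitRow c v with heavy? v
  ... | yes _ = unbit (finToFun (proj₂ (remQuot {m} (2 ^ suc heavyBound) c)) (name v))
  ... | no  _ = row (proj₁ (remQuot {m} (2 ^ suc heavyBound) c)) v

  -- In a heavy column the class of `u` carries the true adjacency to `v`, stored under the name of
  -- `v`, so exceptions remain only in light columns.
  splitRow-exception : ∀ u v → adj G u v ≢ splitRow (splitClass u) v → ¬ Heavy v × adj G u v ≢ row (class u) v
  splitRow-exception u v exc with heavy? v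
  ... | yes heavy = contradiction (sym (begin
      unbit (finToFun (proj₂ (remQuot {m} (2 ^ suc heavyBound) (splitClass u))) (name v))
        ≡⟨ cong (λ p → unbit (finToFun (proj₂ p) (name v))) (remQuot-combine (class u) (funToFin (code u))) ⟩
      unbit (finToFun (funToFin (code u)) (name v)) ≡⟨ cong unbit (finToFun-funToFin (code u) (name v)) ⟩
      unbit (code u (name v))                       ≡⟨ unbit-bit _ ⟩
      does (meets? u (name v))                      ≡⟨ meets-name u heavy ⟩
      adj G u v                                     ∎)) exc
    where open ≡-Reasoning
  ... | no light = light , λ eq → exc
    (trans eq (cong (λ p → row (proj₁ p) v) (sym (remQuot-combine (class u) (funToFin (code u))))))

  lightExceptions : V → List V
  lightExceptions v with heavy? v
  ... | yes _ = []
  ... | no  _ = colExceptions v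

  lightExceptions-bounded : ∀ v → length (lightExceptions v) ≤ lightBound
  lightExceptions-bounded v with heavy? v
  ... | yes _    = z≤n
  ... | no light = ≮⇒≥ light

  ∈-lightExceptions : ∀ {u v} → ¬ Heavy v → adj G u v ≢ row (class u) v → u ∈ lightExceptions v
  ∈-lightExceptions {u} {v} light exc with heavy? v
  ... | yes heavy = contradiction heavy light
  ... | no  _     = ∈-filter-allFin (λ u → exception? u v) exc

  twoSided : TwoSided splitClasses (k + lightBound) G
  twoSided = record
    { class         = splitClass
    ; row           = splitRow
    ; cover         = λ v → exceptions v ++ lightExceptions v
    ; cover-bounded = λ v → ≤-trans (≤-reflexive (length-++ (exceptions v)))
                              (ℕ.+-mono-≤ (exceptions-bounded v) (lightExceptions-bounded v))
    ; covered       = λ u v exc → let light , exc′ = splitRow-exception u v exc in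
        ∈-++⁺ˡ (∈-filter-allFin (exception? u) exc′) ,
        ∈-++⁺ʳ (exceptions v) (∈-lightExceptions light exc′)
    }

-- Decoding a graph from its exceptions

-- `inRow c` marks the columns where pattern `c` is true. `adjTo a` marks vertices adjacent in the
-- original graph to an exception neighbour of hue `a`.
data Symbol (m e : ℕ) : Set where
  inClass   : Fin m → Symbol m e
  inRow     : Fin m → Symbol m e
  inPalette : Fin e → Symbol m e
  adjTo     : Fin e → Symbol m e

⋁ : ∀ {Σ n} k → (Fin k → Formula Σ (suc n)) → Formula Σ (suc n)
⋁ zero    φ = neg (zero ≈ zero)
⋁ (suc k) φ = φ zero ∨ ⋁ k (φ ∘ suc)

⋁⁺ : ∀ {Σ n} {A : Expansion Σ} k (φ : Fin k → Formula Σ (suc n)) {ρ} i → A ⊨ φ i [ ρ ] → A ⊨ ⋁ k φ [ ρ ]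
⋁⁺ (suc k) φ zero    h = inj₁ h
⋁⁺ (suc k) φ (suc i) h = inj₂ (⋁⁺ k (φ ∘ suc) i h)

⋁⁻ : ∀ {Σ n} {A : Expansion Σ} k (φ : Fin k → Formula Σ (suc n)) {ρ} → A ⊨ ⋁ k φ [ ρ ] → ∃[ i ] (A ⊨ φ i [ ρ ])
⋁⁻ zero    φ h        = contradiction refl h
⋁⁻ (suc k) φ (inj₁ h) = zero , h
⋁⁻ (suc k) φ (inj₂ h) with ⋁⁻ k (φ ∘ suc) h
... | i , h′ = suc i , h′

module _ (m e : ℕ) where

  -- Along an edge of the exception graph the adjacency is looked up by the hue of `y`; elsewhere it
  -- is given by the pattern of the class of `x`.
  decode : ∀ {n} → Fin (suc n) → Fin (suc n) → Formula (Symbol m e) (suc n)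
  decode x y = (edge x y ∧ ⋁ e (λ a → hasColour (inPalette a) y ∧ hasColour (adjTo a) x))
             ∨ (neg (edge x y) ∧ ⋁ m (λ c → hasColour (inClass c) x ∧ hasColour (inRow c) y))

  Decoded : (A : Expansion (Symbol m e)) → Vertex (graph A) → Vertex (graph A) → Set
  Decoded A u v =
    (Adjacent (graph A) u v × ∃[ a ] v Subset.∈ colour A (inPalette a) × u Subset.∈ colour A (adjTo a)) ⊎
    (¬ Adjacent (graph A) u v × ∃[ c ] u Subset.∈ colour A (inClass c) × v Subset.∈ colour A (inRow c))

  decode⁺ : ∀ {n} A (x y : Fin (suc n)) ρ → Decoded A (Vec.lookup ρ x) (Vec.lookup ρ y) → A ⊨ decode x y [ ρ ]
  decode⁺ A x y ρ (inj₁ (uv , a , h)) = inj₁ (uv , ⋁⁺ e _ a h)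
  decode⁺ A x y ρ (inj₂ (uv , c , h)) = inj₂ (uv , ⋁⁺ m _ c h)

  decode⁻ : ∀ {n} A (x y : Fin (suc n)) ρ → A ⊨ decode x y [ ρ ] → Decoded A (Vec.lookup ρ x) (Vec.lookup ρ y)
  decode⁻ A x y ρ (inj₁ (uv , h)) = inj₁ (uv , ⋁⁻ e _ h)
  decode⁻ A x y ρ (inj₂ (uv , h)) = inj₂ (uv , ⋁⁻ m _ h)

  -- Inequality and decoding in both orders are demanded so that `η` is symmetric and irreflexive in
  -- every expansion, not only in those that encode a graph.
  decoder : SimpleInterpretation (Symbol m e)
  decoder = record
    { ν = zero ≈ zero
    ; η = neg (zero ≈ suc zero) ∧ (decode zero (suc zero) ∧ decode (suc zero) zero)
    ; η-symmetric   = λ A u v (u≢v , uv , vu) → u≢v ∘ sym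
        , decode⁺ A zero (suc zero) (v ∷ u ∷ []) (decode⁻ A (suc zero) zero (u ∷ v ∷ []) vu)
        , decode⁺ A (suc zero) zero (v ∷ u ∷ []) (decode⁻ A zero (suc zero) (u ∷ v ∷ []) uv)
    ; η-irreflexive = λ A v (v≢v , _) → v≢v refl
    }

≅-trans : ∀ {G H K} → G ≅ H → H ≅ K → G ≅ K
≅-trans G≅H H≅K = record
  { vertices  = _≅_.vertices H≅K ↔-∘ _≅_.vertices G≅H
  ; preserves = λ u v → trans (_≅_.preserves G≅H u v) (_≅_.preserves H≅K _ _)
  }

≅-induced : ∀ G {P : Pred (Vertex G) 0ℓ} (P? : Decidable P) → (∀ v → P v) → G ≅ induced G P?
≅-induced G P? all-P = record
  { vertices  = mk↔ₛ′ (λ v → restrict G P? v (all-P v)) (lookup vs)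
      (λ i → lookup-injective (filter⁺ P? (allFin⁺ (order G))) (lookup-restrict G P? (lookup vs i) (all-P (lookup vs i))))
      (λ v → lookup-restrict G P? v (all-P v))
  ; preserves = λ u v → sym (adj-restrict G P? u (all-P u) v (all-P v))
  }
  where vs = filter P? (allFin (order G))

∈-tabulateˢ⁺ : ∀ {n} {f : Fin n → Bool} {v} → f v ≡ true → v Subset.∈ Vec.tabulate f
∈-tabulateˢ⁺ {f = f} {v} eq = lookup⇒[]= v (Vec.tabulate f) (trans (lookup∘tabulate f v) eq)

∈-tabulateˢ⁻ : ∀ {n} {f : Fin n → Bool} {v} → v Subset.∈ Vec.tabulate f → f v ≡ true
∈-tabulateˢ⁻ {f = f} {v} v∈ = trans (sym (lookup∘tabulate f v)) ([]=⇒lookup v∈)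

does-true : ∀ {A : Set} (A? : Dec A) → does A? ≡ true → A
does-true (yes a) _ = a

module Encode {m k G} (two : TwoSided m k G) where
  open TwoSided two

  private
    V = Vertex G

  Edge : V → V → Set
  Edge u v = u ≢ v × (Exception u v ⊎ Exception v u)

  edge? : ∀ u v → Dec (Edge u v)
  edge? u v = ¬? (u ≟ v) ×-dec (exception? u v ⊎-dec exception? v u)

  Edge-sym : ∀ {u v} → Edge u v → Edge v u
  Edge-sym (u≢v , exc) = u≢v ∘ sym , [ inj₂ , inj₁ ]′ exc

  exceptionGraph : Graph
  exceptionGraph = record
    { order      = order G
    ; adj        = λ u v → does (edge? u v)
    ; adj-sym    = λ u v → does-⇔ (mk⇔ Edge-sym Edge-sym) (edge? u v) (edge? v u)
    ; adj-irrefl = λ v → dec-false (edge? v v) (λ (v≢v , _) → v≢v refl)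
    }

  nbrs : V → List V
  nbrs v = filter (λ w → does (edge? v w) Bool.≟ true) (allFin (order G))

  ∈-nbrs⁺ : ∀ {v w} → Edge v w → w ∈ nbrs v
  ∈-nbrs⁺ {v} vw = ∈-filter-allFin (λ w → does (edge? v w) Bool.≟ true) (dec-true (edge? v _) vw)

  ∈-nbrs⁻ : ∀ {v w} → w ∈ nbrs v → Edge v w
  ∈-nbrs⁻ {v} w∈ = does-true (edge? v _)
    (proj₂ (∈-filter⁻ (λ w → does (edge? v w) Bool.≟ true) {xs = allFin (order G)} w∈))

  nbrs-bounded : ∀ v → length (nbrs v) ≤ k
  nbrs-bounded v = ≤-trans
    (length-mono-unique (cover v) (filter⁺ (λ w → does (edge? v w) Bool.≟ true) (allFin⁺ (order G)))
      λ {w} w∈ → [ proj₁ ∘ covered v w , proj₂ ∘ covered w v ]′ (proj₂ (∈-nbrs⁻ {v} {w} w∈)))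
    (cover-bounded v)

  degree-bounded : ∀ v → degree exceptionGraph v ≤ k
  degree-bounded v = ≤-trans (≤-reflexive (degree-length exceptionGraph v)) (nbrs-bounded v)

  -- A proper colouring of the square of the exception graph: distinct neighbours of one vertex get
  -- distinct hues, so a vertex and a hue determine the neighbour.
  palette : Σ[ e ∈ (V → Fin (suc (k * k))) ] (∀ {u v} → u ∈ concatMap nbrs (nbrs v) → e u ≡ e v → u ≡ v)
  palette = properColouring (λ v → concatMap nbrs (nbrs v))
    (λ v → ≤-trans (length-concatMap (nbrs v) nbrs-bounded) (ℕ.*-monoˡ-≤ k (nbrs-bounded v)))
    λ {u} {v} u∈ → let w , w∈ , u∈w = find (∈-concatMap⁻ nbrs {xs = nbrs v} u∈) in
      ∈-concatMap (∈-nbrs⁺ (Edge-sym (∈-nbrs⁻ u∈w))) (∈-nbrs⁺ (Edge-sym (∈-nbrs⁻ w∈)))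

  hue : V → Fin (suc (k * k))
  hue = proj₁ palette

  adjTo? : ∀ u a → Dec (∃[ v ] Edge u v × hue v ≡ a × adj G u v ≡ true)
  adjTo? u a = any? λ v → edge? u v ×-dec hue v ≟ a ×-dec adj G u v Bool.≟ true

  colouring : Symbol m (suc (k * k)) → Subset (order G)
  colouring (inClass c)   = Vec.tabulate λ v → does (class v ≟ c)
  colouring (inRow c)     = Vec.tabulate (row c)
  colouring (inPalette a) = Vec.tabulate λ v → does (hue v ≟ a)
  colouring (adjTo a)     = Vec.tabulate λ v → does (adjTo? v a)

  expansion : Expansion (Symbol m (suc (k * k)))
  expansion = record { graph = exceptionGraph ; colour = colouring }

  decoded⇒adj : ∀ {u v} → u ≢ v → Decoded m (suc (k * k)) expansion u v → adj G u v ≡ true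
  decoded⇒adj {u} {v} u≢v (inj₁ (uv , a , v∈ , u∈)) =
    let w , uw , w≡ , adj-uw = does-true (adjTo? u a) (∈-tabulateˢ⁻ u∈)
        -- The vertex `w` behind the mark `adjTo a` is `v` itself: both are neighbours of `u` with
        -- hue `a`.
        v≡w = proj₂ palette
          (∈-concatMap (∈-nbrs⁺ (Edge-sym uw)) (∈-nbrs⁺ (does-true (edge? u v) uv)))
          (trans (does-true (hue v ≟ a) (∈-tabulateˢ⁻ v∈)) (sym w≡))
    in trans (cong (adj G u) v≡w) adj-uw
  decoded⇒adj {u} {v} u≢v (inj₂ (¬uv , c , u∈ , v∈)) = trans
    (decidable-stable (adj G u v Bool.≟ row (class u) v)
      (λ exc → ¬uv (dec-true (edge? u v) (u≢v , inj₁ exc))))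
    (trans (cong (λ c → row c v) (does-true (class u ≟ c) (∈-tabulateˢ⁻ u∈))) (∈-tabulateˢ⁻ v∈))

  edge⇒decoded : ∀ {u v} → adj G u v ≡ true → Edge u v → Decoded m (suc (k * k)) expansion u v
  edge⇒decoded {u} {v} uv e = inj₁
    ( dec-true (edge? u v) e , hue v
    , ∈-tabulateˢ⁺ (dec-true (hue v ≟ hue v) refl)
    , ∈-tabulateˢ⁺ (dec-true (adjTo? u (hue v)) (v , e , refl , uv)) )

  adj⇒≢ : ∀ {u v} → adj G u v ≡ true → u ≢ v
  adj⇒≢ {u} uv refl = contradiction (trans (sym uv) (adj-irrefl G u)) λ ()

  nonedge⇒decoded : ∀ {u v} → adj G u v ≡ true → ¬ Edge u v → Decoded m (suc (k * k)) expansion u v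
  nonedge⇒decoded {u} {v} uv ¬e = inj₂
    ( ¬e ∘ does-true (edge? u v) , class u
    , ∈-tabulateˢ⁺ (dec-true (class u ≟ class u) refl)
    , ∈-tabulateˢ⁺ (trans (sym regular) uv) )
    where
    regular : adj G u v ≡ row (class u) v
    regular = decidable-stable (adj G u v Bool.≟ row (class u) v) λ exc → ¬e (adj⇒≢ uv , inj₁ exc)

  adj⇒decoded : ∀ {u v} → adj G u v ≡ true → Decoded m (suc (k * k)) expansion u v
  adj⇒decoded {u} {v} uv = [ edge⇒decoded uv , nonedge⇒decoded uv ]′ (toSum (edge? u v))

  private
    I = decoder m (suc (k * k))

  decodes : G ≅ interpret I expansion
  decodes = ≅-trans {H = η-graph I expansion}
    (record { vertices = ↔-id _ ; preserves = λ u v → sym (η-correct u v) })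
    (≅-induced (η-graph I expansion) (λ v → expansion ⊨? ν I [ v ∷ [] ]) (λ v → refl))
    where
    η-correct : ∀ u v → adj (η-graph I expansion) u v ≡ adj G u v
    η-correct u v = does-≡true (expansion ⊨? η I [ u ∷ v ∷ [] ])
      (λ (u≢v , uv , _) → decoded⇒adj u≢v (decode⁻ m (suc (k * k)) expansion zero (suc zero) (u ∷ v ∷ []) uv))
      (λ uv → adj⇒≢ uv
            , decode⁺ m (suc (k * k)) expansion zero (suc zero) (u ∷ v ∷ []) (adj⇒decoded uv)
            , decode⁺ m (suc (k * k)) expansion (suc zero) zero (u ∷ v ∷ []) (adj⇒decoded (trans (adj-sym G v u) uv)))

-- The two inclusions

decoderTransduction : ℕ → ℕ → Transduction
decoderTransduction m k = record { Symbols = Symbol m (suc (k * k)) ; interpretation = decoder m (suc (k * k)) }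

-- The degree bound and the interpretation depend only on `m` and `k`, so the graphs of degree at
-- most `k` and a single transduction serve the whole class.
twoSided⇒transduction : ∀ C {m k} → (∀ {G} → members C G → TwoSided m k G) → holds transductionOfBoundedDegree C
twoSided⇒transduction C {m} {k} two = (λ H → ∀ v → degree H v ≤ k) , (k , λ _ bounded → bounded)
  , decoderTransduction m k , λ G∈C →
    let open Encode (two G∈C) in exceptionGraph , degree-bounded , colouring , decodes

¬ladder⇒transduction : ∀ C {q} → (∀ {G} → members C G → ¬ Ladder q q G) → holds transductionOfBoundedDegree C
¬ladder⇒transduction C {q} noLadder = twoSided⇒transduction C λ {G} G∈C →
  Heavy.twoSided (¬ladder⇒approximation G (noLadder G∈C ∘ shorten))
  where
  -- The approximation requires rungs of positive length, while `q` may be zero.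
  shorten : ∀ {G} → Ladder q (suc q) G → Ladder q q G
  shorten L = subladder L id id (λ _ → inject₁) (λ _ → inject₁-injective)

-- With a single part every union is an induced subgraph, hence in `C`, which serves as its own
-- class for every `p`.
onePart : ∀ C → holds transductionOfBoundedDegree C → holds (transductionOfBoundedDegree ∗) C
onePart C C∈Π p = (λ _ → 1) , (λ _ → ≤-refl) , (λ k → 1 , λ n 1≤n → ≤-trans (≤-reflexive (ℕ.^-zeroˡ k)) 1≤n)
  , C , C∈Π , λ {G} G∈C → 1 , ≤-refl , (λ _ → zero) ,
    λ i → induced-closed C {G} (λ v → any? λ j → zero ≟ i j) G∈C

mainTheorem4 : IsDecompositionHorizon transductionOfBoundedDegree
mainTheorem4 = (λ {C} C∈Π∗ → ¬ladder⇒transduction C (proj₂ (decomposition⇒¬ladder C C∈Π∗)))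
             , (λ {C} → onePart C)
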